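{- Let $k_1,k_2,k_3\in\mathbb{Z}_{\ge0}$ and let $(P,Q,R)$ be a $(k_1,k_2,k_3)$-CGC triple associated with the non-labeled cluster $(a,b,c)$. Then: (1) the $(1,2)$-entry of $PQ-S_R$ is $\frac{a^2+k_cab+b^2}{c}$ and the $(1,2)$-entry of $QR-S_P$ is $\frac{b^2+k_abc+c^2}{a}$; (2) $\mathrm{tr}(PQ-S_R)=\mathscr{M}m_{12}-k_c$ and $\mathrm{tr}(QR-S_P)=\mathscr{M}n_{12}-k_a$, where $m_{12}$ and $n_{12}$ denote the $(1,2)$-entries of $PQ-S_R$ and $QR-S_P$ respectively; (3) $PQ-S_R,\ QR-S_P\in SL(2,\mathbb{Z}[x_1^{\pm1},x_2^{\pm1},x_3^{\pm1}])$. In particular, $(P,PQ-S_R,Q)$ and $(Q,QR-S_P,R)$ are $(k_1,k_2,k_3)$-CGC triples.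
   Context: Fix $k_1,k_2,k_3\in\mathbb{Z}_{\ge0}$ and indeterminates $x_1,x_2,x_3$. Mutations of triples of nonzero rational functions: $\mu_1(a,b,c)=(\frac{b^2+k_1bc+c^2}{a},b,c)$, $\mu_2(a,b,c)=(a,\frac{a^2+k_2ac+c^2}{b},c)$, $\mu_3(a,b,c)=(a,b,\frac{a^2+k_3ab+b^2}{c})$. A labeled cluster of $\mathcal{A}(k_1,k_2,k_3)$ is a triple obtained from $(x_1,x_2,x_3)$ by finitely many mutations; a non-labeled cluster is any permutation of a labeled cluster; a cluster variable is an entry of a labeled cluster. Each cluster variable $y$ occurs in only one position $i$ among labeled clusters; its parity is $k_y:=k_i$. Let $\mathscr{M}=\frac{x_1^2+x_2^2+x_3^2+k_1x_2x_3+k_2x_1x_3+k_3x_1x_2}{x_1x_2x_3}$. For a $2\times2$ matrix $P=(p_{ij})$ over $\mathbb{Z}[x_1^{\pm1},x_2^{\pm1},x_3^{\pm1}]$ set $S_P=\begin{bmatrix}\mathscr{M}p_{12}-\mathrm{tr}P&0\\(\mathscr{M}p_{12}-\mathrm{tr}P)\mathscr{M}&\mathscr{M}p_{12}-\mathrm{tr}P\end{bmatrix}$. A $(k_1,k_2,k_3)$-CGC matrix is a $P\in SL(2,\mathbb{Z}[x_1^{\pm1},x_2^{\pm1},x_3^{\pm1}])$ whose $(1,2)$-entry $p_{12}$ is a cluster variable and with $\mathrm{tr}(P)=\mathscr{M}p_{12}-k_{p_{12}}$. A $(k_1,k_2,k_3)$-CGC triple is a triple $(P,Q,R)$ of CGC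 matrices with $Q=PR-S_Q$ such that $(p_{12},q_{12},r_{12})$ (the $(1,2)$-entries) is a non-labeled cluster; it is said to be associated with $(p_{12},q_{12},r_{12})$. -}

module Defs where

open import Data.Nat using (ℕ; zero; suc; _∸_)
open import Data.Integer using (ℤ; +_) renaming (_+_ to _+ℤ_; _*_ to _*ℤ_; -_ to -ℤ_)
open import Data.Fin using (Fin; zero; suc)
open import Data.Fin.Permutation using (Permutation′; _⟨$⟩ʳ_)
open import Data.List using (List; []; _∷_; _++_)
open import Data.Product using (Σ; _×_; _,_)
open import Relation.Binary.PropositionalEquality using (_≡_)
open import Relation.Nullary using (¬_)

-- Polynomials in ℤ[x₁,x₂,x₃], given syntactically; two polynomials are
-- equal iff all their coefficients agree.

data Expr : Set where
  con  : ℤ → Expr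
  var  : Fin 3 → Expr
  _⊕_  : Expr → Expr → Expr
  _⊗_  : Expr → Expr → Expr
  neg  : Expr → Expr

ind0 : ℕ → ℤ
ind0 zero = + 1
ind0 (suc _) = + 0

ind1 : ℕ → ℤ
ind1 (suc zero) = + 1
ind1 _ = + 0

sumUpTo : ℕ → (ℕ → ℤ) → ℤ
sumUpTo zero f = f 0
sumUpTo (suc n) f = sumUpTo n f +ℤ f (suc n)

coeff : Expr → ℕ → ℕ → ℕ → ℤ
coeff (con z) i j l = z *ℤ ind0 i *ℤ ind0 j *ℤ ind0 l
coeff (var zero) i j l = ind1 i *ℤ ind0 j *ℤ ind0 l
coeff (var (suc zero)) i j l = ind0 i *ℤ ind1 j *ℤ ind0 l
coeff (var (suc (suc zero))) i j l = ind0 i *ℤ ind0 j *ℤ ind1 l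
coeff (p ⊕ q) i j l = coeff p i j l +ℤ coeff q i j l
coeff (p ⊗ q) i j l =
  sumUpTo i λ a → sumUpTo j λ b → sumUpTo l λ c →
    coeff p a b c *ℤ coeff q (i ∸ a) (j ∸ b) (l ∸ c)
coeff (neg p) i j l = -ℤ coeff p i j l

infix 4 _≈P_
_≈P_ : Expr → Expr → Set
p ≈P q = ∀ i j l → coeff p i j l ≡ coeff q i j l

NonZeroPoly : Set
NonZeroPoly = Σ Expr λ e → ¬ (e ≈P con (+ 0))

var-nz : (i : Fin 3) → ¬ (var i ≈P con (+ 0))
var-nz zero h with h 1 0 0
... | ()
var-nz (suc zero) h with h 0 1 0
... | ()
var-nz (suc (suc zero)) h with h 0 0 1
... | ()

prodL : List NonZeroPoly → Expr
prodL [] = con (+ 1)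
prodL ((e , _) ∷ es) = e ⊗ prodL es

-- The field of rational functions ℚ(x₁,x₂,x₃): fractions num / (product
-- of a list of nonzero polynomials), equality by cross-multiplication.

record Frac : Set where
  constructor _/_
  field
    num : Expr
    den : List NonZeroPoly
open Frac public

infix 4 _≈F_
_≈F_ : Frac → Frac → Set
f ≈F g = (num f ⊗ prodL (den g)) ≈P (num g ⊗ prodL (den f))

infixl 6 _+F_ _-F_
infixl 7 _*F_

_+F_ : Frac → Frac → Frac
f +F g = ((num f ⊗ prodL (den g)) ⊕ (num g ⊗ prodL (den f))) / (den f ++ den g)

_*F_ : Frac → Frac → Frac
f *F g = (num f ⊗ num g) / (den f ++ den g)

-F_ : Frac → Frac
-F f = neg (num f) / den f

_-F_ : Frac → Frac → Frac
f -F g = f +F (-F g)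

↑ : Expr → Frac
↑ e = e / []

natF : ℕ → Frac
natF k = ↑ (con (+ k))

0F 1F : Frac
0F = natF 0
1F = natF 1

X : Fin 3 → Frac
X i = ↑ (var i)

pow : Expr → ℕ → Expr
pow e zero = con (+ 1)
pow e (suc n) = e ⊗ pow e n

Laurent : Frac → Set
Laurent f = Σ Expr λ p → Σ ℕ λ e₁ → Σ ℕ λ e₂ → Σ ℕ λ e₃ →
  (f *F ↑ (pow (var zero) e₁ ⊗ (pow (var (suc zero)) e₂ ⊗ pow (var (suc (suc zero))) e₃)))
    ≈F ↑ p

record Mat : Set where
  constructor mat
  field
    m11 m12 m21 m22 : Frac
open Mat public

infixl 6 _-M_
infixl 7 _*M_

_*M_ : Mat → Mat → Mat
A *M B = mat (m11 A *F m11 B +F m12 A *F m21 B) (m11 A *F m12 B +F m12 A *F m22 B)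
             (m21 A *F m11 B +F m22 A *F m21 B) (m21 A *F m12 B +F m22 A *F m22 B)

_-M_ : Mat → Mat → Mat
A -M B = mat (m11 A -F m11 B) (m12 A -F m12 B) (m21 A -F m21 B) (m22 A -F m22 B)

infix 4 _≈M_
_≈M_ : Mat → Mat → Set
A ≈M B = (m11 A ≈F m11 B) × (m12 A ≈F m12 B) × (m21 A ≈F m21 B) × (m22 A ≈F m22 B)

tr det : Mat → Frac
tr A = m11 A +F m22 A
det A = m11 A *F m22 A -F m12 A *F m21 A

InSL2 : Mat → Set
InSL2 A = Laurent (m11 A) × Laurent (m12 A) × Laurent (m21 A) × Laurent (m22 A)
          × (det A ≈F 1F)

𝓜 : ℕ → ℕ → ℕ → Frac
𝓜 k₁ k₂ k₃ =
  ((((((x₁ ⊗ x₁) ⊕ (x₂ ⊗ x₂)) ⊕ (x₃ ⊗ x₃))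
     ⊕ (con (+ k₁) ⊗ (x₂ ⊗ x₃))) ⊕ (con (+ k₂) ⊗ (x₁ ⊗ x₃))) ⊕ (con (+ k₃) ⊗ (x₁ ⊗ x₂)))
  / ((x₁ , var-nz zero) ∷ (x₂ , var-nz (suc zero)) ∷ (x₃ , var-nz (suc (suc zero))) ∷ [])
  where
  x₁ = var zero
  x₂ = var (suc zero)
  x₃ = var (suc (suc zero))

-- labeled clusters; the mutation a' = (b²+k₁bc+c²)/a is written as
-- a'·a = b²+k₁bc+c²
data LC (k₁ k₂ k₃ : ℕ) : Frac → Frac → Frac → Set where
  init : LC k₁ k₂ k₃ (X zero) (X (suc zero)) (X (suc (suc zero)))
  mut₁ : ∀ {a b c a'} → LC k₁ k₂ k₃ a b c →
         a' *F a ≈F b *F b +F natF k₁ *F b *F c +F c *F c → LC k₁ k₂ k₃ a' b c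
  mut₂ : ∀ {a b c b'} → LC k₁ k₂ k₃ a b c →
         b' *F b ≈F a *F a +F natF k₂ *F a *F c +F c *F c → LC k₁ k₂ k₃ a b' c
  mut₃ : ∀ {a b c c'} → LC k₁ k₂ k₃ a b c →
         c' *F c ≈F a *F a +F natF k₃ *F a *F b +F b *F b → LC k₁ k₂ k₃ a b c'

sel : Fin 3 → Frac → Frac → Frac → Frac
sel zero a b c = a
sel (suc zero) a b c = b
sel (suc (suc zero)) a b c = c

kOf : ℕ → ℕ → ℕ → Fin 3 → ℕ
kOf k₁ k₂ k₃ zero = k₁
kOf k₁ k₂ k₃ (suc zero) = k₂
kOf k₁ k₂ k₃ (suc (suc zero)) = k₃

ClusterVarAt : ℕ → ℕ → ℕ → Fin 3 → Frac → Set
ClusterVarAt k₁ k₂ k₃ i y =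
  Σ Frac λ a → Σ Frac λ b → Σ Frac λ c → LC k₁ k₂ k₃ a b c × (sel i a b c ≈F y)

NonLabeled : ℕ → ℕ → ℕ → Frac → Frac → Frac → Set
NonLabeled k₁ k₂ k₃ p q r =
  Σ Frac λ a → Σ Frac λ b → Σ Frac λ c → LC k₁ k₂ k₃ a b c ×
  Σ (Permutation′ 3) λ π →
    (sel (π ⟨$⟩ʳ zero) a b c ≈F p) × (sel (π ⟨$⟩ʳ suc zero) a b c ≈F q)
    × (sel (π ⟨$⟩ʳ suc (suc zero)) a b c ≈F r)

S : ℕ → ℕ → ℕ → Mat → Mat
S k₁ k₂ k₃ P = mat s 0F (s *F 𝓜 k₁ k₂ k₃) s
  where s = 𝓜 k₁ k₂ k₃ *F m12 P -F tr P

-- (k₁,k₂,k₃)-CGC matrix; the parity of p₁₂ is k_i where i is its position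
IsCGC : ℕ → ℕ → ℕ → Mat → Set
IsCGC k₁ k₂ k₃ P = InSL2 P × Σ (Fin 3) λ i → ClusterVarAt k₁ k₂ k₃ i (m12 P)
  × (tr P ≈F 𝓜 k₁ k₂ k₃ *F m12 P -F natF (kOf k₁ k₂ k₃ i))

CGCTriple : ℕ → ℕ → ℕ → Mat → Mat → Mat → Set
CGCTriple k₁ k₂ k₃ P Q R =
  IsCGC k₁ k₂ k₃ P × IsCGC k₁ k₂ k₃ Q × IsCGC k₁ k₂ k₃ R
  × (Q ≈M P *M R -M S k₁ k₂ k₃ Q)
  × NonLabeled k₁ k₂ k₃ (m12 P) (m12 Q) (m12 R)

{-# OPTIONS --safe #-}

-- The (1,2)-entries of a CGC triple satisfy the Markov-type equation
--   a² + b² + c² + kₐ b c + k_b a c + k_c a b = 𝓜 a b c,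
-- which holds for (x₁, x₂, x₃) and survives mutation because a′ = (b² + kₐ b c + c²) / a is
-- the other root of this equation, monic quadratic in a.  Since Q = P R − S_Q, the
-- Cayley–Hamilton identity for P expresses P Q = P² R − P S_Q through P R and R; this gives the
-- (1,2)-entry (𝓜 a − kₐ) b − c − k_b a of P Q − S_R, which the Markov equation turns into
-- (a² + k_c a b + b²) / c, and likewise the trace and the determinant.  The claims on Q R − S_P
-- follow by exchanging the diagonal entries, an anti-automorphism.
--
-- The parity of a cluster variable is well defined: a mutation replaces a by a quotient of
-- b² + k b c + c² by a, and for subtraction-free expressions the order of the former in each x_d
-- is even, so the parity of the x_d-order of a cluster variable depends only on its position.
module Submission where

open import Defs
open import Algebra.Bundles using (CommutativeRing; RawRing)
import Algebra.Consequences.Setoid as Consequences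
import Algebra.Morphism.RingMonomorphism as RingMonomorphism
open import Algebra.Morphism.Structures using (module RingMorphisms)
open import Algebra.Solver.Ring.AlmostCommutativeRing using (fromCommutativeRing; _-Raw-AlmostCommutative⟶_)
open import Data.Bool using (if_then_else_)
open import Data.Fin using (Fin; zero; suc)
open import Data.Fin.Patterns using () renaming (0F to 0₃; 1F to 1₃; 2F to 2₃)
open import Data.Fin.Permutation using (Permutation′; _⟨$⟩ʳ_; _⟨$⟩ˡ_; inverseˡ; transpose; _∘ₚ_)
import Data.Fin.Properties as Fin
open import Data.Integer as ℤ using (ℤ; +_; -[1+_]; _⊖_; +≤+; +<+)
import Data.Integer.Properties as ℤ
open import Data.List using ([]; _∷_; _++_)
open import Data.Maybe using (Maybe; just; nothing)
open import Data.Nat as ℕ using (ℕ; zero; suc; z≤n; s≤s)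
import Data.Nat.Properties as ℕ
open import Data.Nat.Solver using (module +-*-Solver)
open import Data.Product using (_×_; _,_; ∃-syntax)
open import Data.Sum using (_⊎_; inj₁; inj₂)
open import Level using (_⊔_)
open import Relation.Binary.Bundles using (Setoid)
open import Relation.Binary.PropositionalEquality as ≡ using (_≡_; _≢_)
import Relation.Binary.Reasoning.Setoid as SetoidReasoning
open import Relation.Binary.Structures using (IsEquivalence)
open import Relation.Nullary using (¬_; yes; no; does; contradiction)
open import Relation.Nullary.Decidable using (decidable-stable)

-- Fractions are syntactic and equal by cross-multiplication, so already the transitivity of
-- equality needs ℤ[x₁,x₂,x₃] to be an integral domain. Coefficients embed the polynomials in
-- ℤ[[x₃]][[x₂]][[x₁]], where the product has a short recursion. Vanishing of a series is not
-- decidable, so the absence of zero divisors is carried in doubly negated form, and stability of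
-- equality, inherited from ℤ, removes the negations.
--
-- Uniqueness of positions is needed because each CGC matrix brings its own index, witnessed by a
-- labeled cluster unrelated to that of the triple; only uniqueness matches the parities in the
-- traces with those in the Markov equation.
--
-- A cluster is known only through its mutation equations, so its entries may be arbitrary
-- representatives of their fractions, with signs and common factors. Orders are therefore read off
-- from some equal fraction with nonnegative coefficients. The same fraction shows that the entry is
-- nonzero, which is what allows cancelling a when passing to the other root of the quadratic.

-- Ring solver with integer coefficients

module IntegerCoefficientSolver {r ℓ} (R : CommutativeRing r ℓ) where
  open CommutativeRing R
  open import Algebra.Properties.Ring ring using (-‿distribˡ-*; -‿distribʳ-*; -‿involutive; -0#≈0#)
  open import Algebra.Properties.AbelianGroup +-abelianGroup using (⁻¹-∙-comm)
  open import Algebra.Properties.Semiring.Mult semiring using (×-homo-+; ×1-homo-*) renaming (_×_ to _⋆_)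
  open import Relation.Binary.Reasoning.Setoid setoid

  -- For opposite terms to cancel, the solver needs an equality test on its coefficients. The
  -- carriers used below come with none; ℤ has one and maps to every commutative ring.
  fromℤ : ℤ → Carrier
  fromℤ (+ n)    = n ⋆ 1#
  fromℤ -[1+ n ] = - (suc n ⋆ 1#)

  fromℤ-neg : ∀ i → fromℤ (ℤ.- i) ≈ - fromℤ i
  fromℤ-neg (+ zero)  = sym -0#≈0#
  fromℤ-neg (+ suc n) = refl
  fromℤ-neg -[1+ n ]  = sym (-‿involutive _)

  fromℤ-⊖ : ∀ m n → fromℤ (m ⊖ n) ≈ m ⋆ 1# - n ⋆ 1#
  fromℤ-⊖ m zero = begin
    m ⋆ 1#      ≈⟨ +-identityʳ _ ⟨
    m ⋆ 1# + 0# ≈⟨ +-congˡ -0#≈0# ⟨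
    m ⋆ 1# - 0# ∎
  fromℤ-⊖ zero (suc n) = sym (+-identityˡ _)
  fromℤ-⊖ (suc m) (suc n) = begin
    fromℤ (suc m ⊖ suc n)                   ≡⟨ ≡.cong fromℤ (ℤ.[1+m]⊖[1+n]≡m⊖n m n) ⟩
    fromℤ (m ⊖ n)                           ≈⟨ fromℤ-⊖ m n ⟩
    m ⋆ 1# - n ⋆ 1#                         ≈⟨ +-congʳ (+-identityˡ _) ⟨
    0# + m ⋆ 1# - n ⋆ 1#                    ≈⟨ +-congʳ (+-congʳ (-‿inverseʳ 1#)) ⟨
    1# - 1# + m ⋆ 1# - n ⋆ 1#               ≈⟨ +-congʳ (+-assoc _ _ _) ⟩
    1# + (- 1# + m ⋆ 1#) - n ⋆ 1#           ≈⟨ +-congʳ (+-congˡ (+-comm _ _)) ⟩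
    1# + (m ⋆ 1# - 1#) - n ⋆ 1#             ≈⟨ +-congʳ (+-assoc _ _ _) ⟨
    1# + m ⋆ 1# - 1# - n ⋆ 1#               ≈⟨ +-assoc _ _ _ ⟩
    1# + m ⋆ 1# + (- 1# - n ⋆ 1#)           ≈⟨ +-congˡ (⁻¹-∙-comm _ _) ⟩
    1# + m ⋆ 1# - (1# + n ⋆ 1#)             ∎

  fromℤ-+ : ∀ i j → fromℤ (i ℤ.+ j) ≈ fromℤ i + fromℤ j
  fromℤ-+ (+ m)    (+ n)    = ×-homo-+ 1# m n
  fromℤ-+ (+ m)    -[1+ n ] = fromℤ-⊖ m (suc n)
  fromℤ-+ -[1+ m ] (+ n)    = trans (fromℤ-⊖ n (suc m)) (+-comm _ _)
  fromℤ-+ -[1+ m ] -[1+ n ] = begin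
    - (suc (suc (m ℕ.+ n)) ⋆ 1#)        ≡⟨ ≡.cong (λ k → - (suc k ⋆ 1#)) (ℕ.+-suc m n) ⟨
    - ((suc m ℕ.+ suc n) ⋆ 1#)          ≈⟨ -‿cong (×-homo-+ 1# (suc m) (suc n)) ⟩
    - (suc m ⋆ 1# + suc n ⋆ 1#)         ≈⟨ ⁻¹-∙-comm _ _ ⟨
    - (suc m ⋆ 1#) - (suc n ⋆ 1#)       ∎

  fromℤ-pos-* : ∀ m j → fromℤ (+ m ℤ.* j) ≈ m ⋆ 1# * fromℤ j
  fromℤ-pos-* m (+ n) = begin
    fromℤ (+ m ℤ.* + n)   ≡⟨ ≡.cong fromℤ (ℤ.pos-* m n) ⟨
    (m ℕ.* n) ⋆ 1#        ≈⟨ ×1-homo-* m n ⟩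
    m ⋆ 1# * (n ⋆ 1#)     ∎
  fromℤ-pos-* m -[1+ n ] = begin
    fromℤ (+ m ℤ.* -[1+ n ])       ≡⟨ ≡.cong fromℤ (ℤ.neg-distribʳ-* (+ m) (+ suc n)) ⟨
    fromℤ (ℤ.- (+ m ℤ.* + suc n))  ≈⟨ fromℤ-neg (+ m ℤ.* + suc n) ⟩
    - fromℤ (+ m ℤ.* + suc n)      ≈⟨ -‿cong (fromℤ-pos-* m (+ suc n)) ⟩
    - (m ⋆ 1# * (suc n ⋆ 1#))      ≈⟨ -‿distribʳ-* _ _ ⟩
    m ⋆ 1# * - (suc n ⋆ 1#)        ∎

  fromℤ-* : ∀ i j → fromℤ (i ℤ.* j) ≈ fromℤ i * fromℤ j
  fromℤ-* (+ m) j    = fromℤ-pos-* m j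
  fromℤ-* -[1+ m ] j = begin
    fromℤ (-[1+ m ] ℤ.* j)         ≡⟨ ≡.cong fromℤ (ℤ.neg-distribˡ-* (+ suc m) j) ⟨
    fromℤ (ℤ.- (+ suc m ℤ.* j))    ≈⟨ fromℤ-neg (+ suc m ℤ.* j) ⟩
    - fromℤ (+ suc m ℤ.* j)        ≈⟨ -‿cong (fromℤ-pos-* (suc m) j) ⟩
    - (suc m ⋆ 1# * fromℤ j)       ≈⟨ -‿distribˡ-* _ _ ⟩
    - (suc m ⋆ 1#) * fromℤ j       ∎

  fromℤ-morphism : CommutativeRing.rawRing ℤ.+-*-commutativeRing -Raw-AlmostCommutative⟶ fromCommutativeRing R
  fromℤ-morphism = record
    { ⟦_⟧    = fromℤ
    ; +-homo = fromℤ-+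
    ; *-homo = fromℤ-*
    ; -‿homo = fromℤ-neg
    ; 0-homo = refl
    ; 1-homo = +-identityʳ 1#
    }

  fromℤ-≟ : ∀ i j → Maybe (fromℤ i ≈ fromℤ j)
  fromℤ-≟ i j with i ℤ.≟ j
  ... | yes i≡j = just (reflexive (≡.cong fromℤ i≡j))
  ... | no  _   = nothing

  open import Algebra.Solver.Ring _ (fromCommutativeRing R) fromℤ-morphism fromℤ-≟ public
    using (solve; _:=_; _:+_; _:*_; _:-_; :-_; con)

-- Formal power series

-- Over series one cannot tell which factor of a vanishing product vanishes, nor extract a nonzero
-- coefficient from a nonzero series. The doubly negated form is the one that passes from
-- coefficients to series; `StableEquality` turns its conclusion back into an equality.
NoZeroDivisors : ∀ {r ℓ} → CommutativeRing r ℓ → Set _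
NoZeroDivisors R = ∀ {x y} → x * y ≈ 0# → ¬ x ≈ 0# → ¬ ¬ y ≈ 0#
  where open CommutativeRing R

StableEquality : ∀ {r ℓ} → CommutativeRing r ℓ → Set _
StableEquality R = ∀ {x y} → ¬ ¬ x ≈ y → x ≈ y
  where open CommutativeRing R

module PowerSeries {r ℓ} (R : CommutativeRing r ℓ) where
  open CommutativeRing R
  open import Relation.Binary.Reasoning.Setoid setoid
  open IntegerCoefficientSolver R

  Series : Set r
  Series = ℕ → Carrier

  infix 4 _≋_
  _≋_ : Series → Series → Set ℓ
  f ≋ g = ∀ n → f n ≈ g n

  shift : Series → Series
  shift f n = f (suc n)

  infixl 6 _⊞_
  infixl 7 _⊠_ _·_
  _⊞_ : Series → Series → Series
  (f ⊞ g) n = f n + g n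

  ⊟_ : Series → Series
  (⊟ f) n = - f n

  _·_ : Carrier → Series → Series
  (c · f) n = c * f n

  -- The Cauchy product, by the rule  (f g)′ = f(0) g′ + f′ g  for the shift f ↦ f′.
  _⊠_ : Series → Series → Series
  (f ⊠ g) zero    = f 0 * g 0
  (f ⊠ g) (suc n) = f 0 * g (suc n) + (shift f ⊠ g) n

  constant : Carrier → Series
  constant c zero    = c
  constant c (suc n) = 0#

  ⊠-cong : ∀ {f f′ g g′} → f ≋ f′ → g ≋ g′ → f ⊠ g ≋ f′ ⊠ g′
  ⊠-cong p q zero    = *-cong (p 0) (q 0)
  ⊠-cong p q (suc n) = +-cong (*-cong (p 0) (q (suc n))) (⊠-cong (λ m → p (suc m)) q n)

  -- The recursion of `_⊠_` seen from the second factor; the induction for commutativity alternates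
  -- between the two.
  ⊠-suc : ∀ f g n → (f ⊠ g) (suc n) ≈ f (suc n) * g 0 + (f ⊠ shift g) n
  ⊠-suc f g zero    = +-comm _ _
  ⊠-suc f g (suc n) = begin
    f 0 * g (suc (suc n)) + (shift f ⊠ g) (suc n)
      ≈⟨ +-congˡ (⊠-suc (shift f) g n) ⟩
    f 0 * g (suc (suc n)) + (f (suc (suc n)) * g 0 + (shift f ⊠ shift g) n)
      ≈⟨ solve 3 (λ x y z → x :+ (y :+ z) := y :+ (x :+ z)) refl _ _ _ ⟩
    f (suc (suc n)) * g 0 + (f 0 * g (suc (suc n)) + (shift f ⊠ shift g) n) ∎

  ⊠-comm : ∀ f g → f ⊠ g ≋ g ⊠ f
  ⊠-comm f g zero    = *-comm _ _
  ⊠-comm f g (suc n) = begin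
    f 0 * g (suc n) + (shift f ⊠ g) n ≈⟨ +-cong (*-comm _ _) (⊠-comm (shift f) g n) ⟩
    g (suc n) * f 0 + (g ⊠ shift f) n ≈⟨ ⊠-suc g f n ⟨
    (g ⊠ f) (suc n)                   ∎

  ⊠-distribʳ-⊞ : ∀ f g h → (g ⊞ h) ⊠ f ≋ (g ⊠ f) ⊞ (h ⊠ f)
  ⊠-distribʳ-⊞ f g h zero    = distribʳ _ _ _
  ⊠-distribʳ-⊞ f g h (suc n) = begin
    (g 0 + h 0) * f (suc n) + ((shift g ⊞ shift h) ⊠ f) n
      ≈⟨ +-congˡ (⊠-distribʳ-⊞ f (shift g) (shift h) n) ⟩
    (g 0 + h 0) * f (suc n) + ((shift g ⊠ f) n + (shift h ⊠ f) n)
      ≈⟨ solve 5 (λ g h f x y → (g :+ h) :* f :+ (x :+ y) := g :* f :+ x :+ (h :* f :+ y))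
           refl _ _ _ _ _ ⟩
    g 0 * f (suc n) + (shift g ⊠ f) n + (h 0 * f (suc n) + (shift h ⊠ f) n) ∎

  ·-⊠ : ∀ c f g → (c · f) ⊠ g ≋ c · (f ⊠ g)
  ·-⊠ c f g zero    = *-assoc _ _ _
  ·-⊠ c f g (suc n) = begin
    c * f 0 * g (suc n) + ((c · shift f) ⊠ g) n ≈⟨ +-congˡ (·-⊠ c (shift f) g n) ⟩
    c * f 0 * g (suc n) + c * (shift f ⊠ g) n
      ≈⟨ solve 4 (λ c x y z → c :* x :* y :+ c :* z := c :* (x :* y :+ z)) refl _ _ _ _ ⟩
    c * (f 0 * g (suc n) + (shift f ⊠ g) n)     ∎

  -- By definition the shift of `f ⊠ g` is `(f 0 · shift g) ⊞ (shift f ⊠ g)`, so distributivity and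
  -- `·-⊠` reduce the claim to the one for `shift f`.
  ⊠-assoc : ∀ f g h → (f ⊠ g) ⊠ h ≋ f ⊠ (g ⊠ h)
  ⊠-assoc f g h zero    = *-assoc _ _ _
  ⊠-assoc f g h (suc n) = begin
    f 0 * g 0 * h (suc n) + (((f 0 · shift g) ⊞ (shift f ⊠ g)) ⊠ h) n
      ≈⟨ +-congˡ (⊠-distribʳ-⊞ h (f 0 · shift g) (shift f ⊠ g) n) ⟩
    f 0 * g 0 * h (suc n) + (((f 0 · shift g) ⊠ h) n + ((shift f ⊠ g) ⊠ h) n)
      ≈⟨ +-congˡ (+-cong (·-⊠ (f 0) (shift g) h n) (⊠-assoc (shift f) g h n)) ⟩
    f 0 * g 0 * h (suc n) + (f 0 * (shift g ⊠ h) n + (shift f ⊠ (g ⊠ h)) n)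
      ≈⟨ solve 5 (λ f g h x y → f :* g :* h :+ (f :* x :+ y) := f :* (g :* h :+ x) :+ y)
           refl _ _ _ _ _ ⟩
    f 0 * (g 0 * h (suc n) + (shift g ⊠ h) n) + (shift f ⊠ (g ⊠ h)) n ∎

  ⊠-zeroˡ : ∀ f → (λ _ → 0#) ⊠ f ≋ λ _ → 0#
  ⊠-zeroˡ f zero    = zeroˡ _
  ⊠-zeroˡ f (suc n) = trans (+-cong (zeroˡ _) (⊠-zeroˡ f n)) (+-identityˡ _)

  ⊠-identityˡ : ∀ f → constant 1# ⊠ f ≋ f
  ⊠-identityˡ f zero    = *-identityˡ _
  ⊠-identityˡ f (suc n) = trans (+-cong (*-identityˡ _) (⊠-zeroˡ f n)) (+-identityʳ _)

  series : CommutativeRing r ℓ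
  series = record
    { Carrier = Series
    ; _≈_     = _≋_
    ; _+_     = _⊞_
    ; _*_     = _⊠_
    ; -_      = ⊟_
    ; 0#      = λ _ → 0#
    ; 1#      = constant 1#
    ; isCommutativeRing = record
      { isRing = record
        { +-isAbelianGroup = record
          { isGroup = record
            { isMonoid = record
              { isSemigroup = record
                { isMagma = record
                  { isEquivalence = record
                    { refl  = λ _ → refl
                    ; sym   = λ p n → sym (p n)
                    ; trans = λ p q n → trans (p n) (q n)
                    }
                  ; ∙-cong = λ p q n → +-cong (p n) (q n)
                  }
                ; assoc = λ f g h n → +-assoc _ _ _
                }
              ; identity = (λ f n → +-identityˡ _) , (λ f n → +-identityʳ _)
              }
            ; inverse = (λ f n → -‿inverseˡ _) , (λ f n → -‿inverseʳ _)
            ; ⁻¹-cong = λ p n → -‿cong (p n)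
            }
          ; comm = λ f g n → +-comm _ _
          }
        ; *-cong     = ⊠-cong
        ; *-assoc    = ⊠-assoc
        ; *-identity = ⊠-identityˡ , λ f n → trans (⊠-comm f (constant 1#) n) (⊠-identityˡ f n)
        ; distrib    = (λ f g h n → begin
              (f ⊠ (g ⊞ h)) n           ≈⟨ ⊠-comm f (g ⊞ h) n ⟩
              ((g ⊞ h) ⊠ f) n           ≈⟨ ⊠-distribʳ-⊞ f g h n ⟩
              (g ⊠ f) n + (h ⊠ f) n     ≈⟨ +-cong (⊠-comm g f n) (⊠-comm h f n) ⟩
              (f ⊠ g) n + (f ⊠ h) n     ∎)
            , ⊠-distribʳ-⊞
        }
      ; *-comm = ⊠-comm
      }
    }

  stable : StableEquality R → StableEquality series
  stable st ¬¬f≋g n = st λ fn≉gn → ¬¬f≋g λ f≋g → fn≉gn (f≋g n)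

  shiftˡ-annihilates : ∀ f g → f ⊠ g ≋ (λ _ → 0#) → f 0 ≈ 0# → shift f ⊠ g ≋ λ _ → 0#
  shiftˡ-annihilates f g fg≋0 f0≈0 n = begin
    (shift f ⊠ g) n                   ≈⟨ +-identityˡ _ ⟨
    0# + (shift f ⊠ g) n              ≈⟨ +-congʳ (trans (*-congʳ f0≈0) (zeroˡ _)) ⟨
    f 0 * g (suc n) + (shift f ⊠ g) n ≈⟨ fg≋0 (suc n) ⟩
    0#                                ∎

  shiftʳ-annihilates : ∀ f g → f ⊠ g ≋ (λ _ → 0#) → g 0 ≈ 0# → f ⊠ shift g ≋ λ _ → 0#
  shiftʳ-annihilates f g fg≋0 g0≈0 n = begin
    (f ⊠ shift g) n ≈⟨ ⊠-comm f (shift g) n ⟩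
    (shift g ⊠ f) n ≈⟨ shiftˡ-annihilates g f (λ m → trans (⊠-comm g f m) (fg≋0 m)) g0≈0 n ⟩
    0#              ∎

  module _ (nzd : NoZeroDivisors R) where

    -- Vanishing constant terms are shifted away until both are nonzero.
    nonzero-product₀ : ∀ f g n → ¬ f 0 ≈ 0# → ¬ g n ≈ 0# → ¬ f ⊠ g ≋ (λ _ → 0#)
    nonzero-product₀ f g zero    f0≉0 gn≉0 fg≋0 = nzd (fg≋0 0) f0≉0 gn≉0
    nonzero-product₀ f g (suc n) f0≉0 gn≉0 fg≋0 = nzd (fg≋0 0) f0≉0 λ g0≈0 →
      nonzero-product₀ f (shift g) n f0≉0 gn≉0 (shiftʳ-annihilates f g fg≋0 g0≈0)

    nonzero-product : ∀ f g m n → ¬ f m ≈ 0# → ¬ g n ≈ 0# → ¬ f ⊠ g ≋ (λ _ → 0#)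
    nonzero-product f g zero    n fm≉0 gn≉0 fg≋0 = nonzero-product₀ f g n fm≉0 gn≉0 fg≋0
    -- Instead of a case distinction on `f 0 ≈ 0#`, the recursive call refutes it: if `f 0`
    -- vanished, `shift f` would annihilate `g` as well. This refutation is the hypothesis that
    -- `nonzero-product₀` asks for.
    nonzero-product f g (suc m) n fm≉0 gn≉0 fg≋0 = nonzero-product₀ f g n
      (λ f0≈0 → nonzero-product (shift f) g m n fm≉0 gn≉0 (shiftˡ-annihilates f g fg≋0 f0≈0))
      gn≉0 fg≋0

  noZeroDivisors : StableEquality R → NoZeroDivisors R → NoZeroDivisors series
  noZeroDivisors st nzd {f} {g} fg≋0 f≉0 g≉0 =
    f≉0 λ m → st λ fm≉0 → g≉0 λ n → st λ gn≉0 → nonzero-product nzd f g m n fm≉0 gn≉0 fg≋0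

  sum≤ : ℕ → (ℕ → Carrier) → Carrier
  sum≤ zero    f = f 0
  sum≤ (suc n) f = sum≤ n f + f (suc n)

  sum≤-suc : ∀ n f → sum≤ (suc n) f ≈ f 0 + sum≤ n (λ a → f (suc a))
  sum≤-suc zero    f = refl
  sum≤-suc (suc n) f = trans (+-congʳ (sum≤-suc n f)) (+-assoc _ _ _)

  ⊠-as-sum : ∀ f g n → (f ⊠ g) n ≈ sum≤ n (λ a → f a * g (n ℕ.∸ a))
  ⊠-as-sum f g zero    = refl
  ⊠-as-sum f g (suc n) = begin
    f 0 * g (suc n) + (shift f ⊠ g) n
      ≈⟨ +-congˡ (⊠-as-sum (shift f) g n) ⟩
    f 0 * g (suc n) + sum≤ n (λ a → f (suc a) * g (n ℕ.∸ a))
      ≈⟨ sum≤-suc n (λ a → f a * g (suc n ℕ.∸ a)) ⟨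
    sum≤ (suc n) (λ a → f a * g (suc n ℕ.∸ a)) ∎

-- Polynomials in three variables as iterated power series

ℤ-stable : StableEquality ℤ.+-*-commutativeRing
ℤ-stable {x} {y} = decidable-stable (x ℤ.≟ y)

ℤ-noZeroDivisors : NoZeroDivisors ℤ.+-*-commutativeRing
ℤ-noZeroDivisors {x} xy≡0 x≢0 y≢0 with ℤ.i*j≡0⇒i≡0∨j≡0 x xy≡0
... | inj₁ x≡0 = x≢0 x≡0
... | inj₂ y≡0 = y≢0 y≡0

module PS₁ = PowerSeries ℤ.+-*-commutativeRing
module PS₂ = PowerSeries PS₁.series
module PS₃ = PowerSeries PS₂.series

sum≤-apply : ∀ {r ℓ} (R : CommutativeRing r ℓ) →
             let module PS = PowerSeries R; module PS′ = PowerSeries PS.series in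
             ∀ n f k → PS′.sum≤ n f k ≡ PS.sum≤ n (λ a → f a k)
sum≤-apply R zero    f k = ≡.refl
sum≤-apply R (suc n) f k = ≡.cong₂ _+_ (sum≤-apply R n f k) ≡.refl
  where open CommutativeRing R

sumUpTo≡sum≤ : ∀ n f → sumUpTo n f ≡ PS₁.sum≤ n f
sumUpTo≡sum≤ zero    f = ≡.refl
sumUpTo≡sum≤ (suc n) f = ≡.cong (ℤ._+ f (suc n)) (sumUpTo≡sum≤ n f)

-- Curried, `coeff p` is a series in x₁ whose coefficients are series in x₂ over series in x₃; the
-- three nested sums are the Cauchy products of these three levels, x₁ outermost.
coeff-⊗ : ∀ p q i j l → coeff (p ⊗ q) i j l ≡ (coeff p PS₃.⊠ coeff q) i j l
coeff-⊗ p q i j l = ≡.sym (begin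
  (coeff p PS₃.⊠ coeff q) i j l
    ≡⟨ PS₃.⊠-as-sum (coeff p) (coeff q) i j l ⟩
  PS₃.sum≤ i (λ a → coeff p a PS₂.⊠ coeff q (i ℕ.∸ a)) j l
    ≡⟨ ≡.cong (λ f → f l) (sum≤-apply PS₁.series i _ j) ⟩
  PS₂.sum≤ i (λ a → (coeff p a PS₂.⊠ coeff q (i ℕ.∸ a)) j) l
    ≡⟨ sum≤-apply ℤ.+-*-commutativeRing i _ l ⟩
  PS₁.sum≤ i (λ a → (coeff p a PS₂.⊠ coeff q (i ℕ.∸ a)) j l)
    ≡⟨ sumUpTo≡sum≤ i _ ⟨
  sumUpTo i (λ a → (coeff p a PS₂.⊠ coeff q (i ℕ.∸ a)) j l)
    ≡⟨ sumUpTo-cong i (λ a → ≡.trans (PS₂.⊠-as-sum _ _ j l)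
         (≡.trans (sum≤-apply ℤ.+-*-commutativeRing j _ l) (≡.sym (sumUpTo≡sum≤ j _)))) ⟩
  sumUpTo i (λ a → sumUpTo j (λ b → (coeff p a b PS₁.⊠ coeff q (i ℕ.∸ a) (j ℕ.∸ b)) l))
    ≡⟨ sumUpTo-cong i (λ a → sumUpTo-cong j λ b → ≡.trans (PS₁.⊠-as-sum _ _ l) (≡.sym (sumUpTo≡sum≤ l _))) ⟩
  coeff (p ⊗ q) i j l ∎)
  where
  open ≡.≡-Reasoning
  sumUpTo-cong : ∀ n {f g : ℕ → ℤ} → (∀ a → f a ≡ g a) → sumUpTo n f ≡ sumUpTo n g
  sumUpTo-cong zero    f≡g = f≡g 0
  sumUpTo-cong (suc n) f≡g = ≡.cong₂ ℤ._+_ (sumUpTo-cong n f≡g) (f≡g (suc n))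

-- p and q cannot be inferred from p ≈P q, which unfolds to an equation between coefficients;
-- from the record they can.
infix 4 _≃P_
record _≃P_ (p q : Expr) : Set where
  constructor ≈P⇒≃P
  field ≃P⇒≈P : p ≈P q
open _≃P_ public

polyRawRing : RawRing _ _
polyRawRing = record
  { Carrier = Expr ; _≈_ = _≃P_ ; _+_ = _⊕_ ; _*_ = _⊗_ ; -_ = neg ; 0# = con (+ 0) ; 1# = con (+ 1) }

coeff-1 : ∀ i j l → coeff (con (+ 1)) i j l ≡ CommutativeRing.1# PS₃.series i j l
coeff-1 zero    zero    zero    = ≡.refl
coeff-1 zero    zero    (suc l) = ≡.refl
coeff-1 zero    (suc j) l       = ≡.refl
coeff-1 (suc i) j       l       = ≡.refl

-- Injectivity is the definition of equality of polynomials, so the ring laws on `Expr` are pulled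
-- back from series instead of being proved on syntax.
coeff-isRingMonomorphism : RingMorphisms.IsRingMonomorphism polyRawRing (CommutativeRing.rawRing PS₃.series) coeff
coeff-isRingMonomorphism = record
  { isRingHomomorphism = record
    { isSemiringHomomorphism = record
      { isNearSemiringHomomorphism = record
        { +-isMonoidHomomorphism = record
          { isMagmaHomomorphism = record
            { isRelHomomorphism = record { cong = ≃P⇒≈P }
            ; homo = λ p q i j l → ≡.refl
            }
          ; ε-homo = λ i j l → ≡.refl
          }
        ; *-homo = coeff-⊗
        }
      ; 1#-homo = coeff-1
      }
    ; -‿homo = λ p i j l → ≡.refl
    }
  ; injective = ≈P⇒≃P
  }

polyRing : CommutativeRing _ _
polyRing = record
  { isCommutativeRing =
      RingMonomorphism.isCommutativeRing coeff-isRingMonomorphism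
        (CommutativeRing.isCommutativeRing PS₃.series) }

module Poly = CommutativeRing polyRing
module PolySolver = IntegerCoefficientSolver polyRing

poly-stable : StableEquality polyRing
poly-stable ¬¬p≃q = ≈P⇒≃P (PS₃.stable (PS₂.stable (PS₁.stable ℤ-stable)) λ p≉q →
  ¬¬p≃q λ p≃q → p≉q (≃P⇒≈P p≃q))

poly-noZeroDivisors : NoZeroDivisors polyRing
poly-noZeroDivisors {p} {q} pq≃0 p≄0 q≄0 =
  PS₃.noZeroDivisors (PS₂.stable (PS₁.stable ℤ-stable))
    (PS₂.noZeroDivisors (PS₁.stable ℤ-stable) (PS₁.noZeroDivisors ℤ-stable ℤ-noZeroDivisors))
    {coeff p} {coeff q} (λ i j l → ≡.trans (≡.sym (coeff-⊗ p q i j l)) (≃P⇒≈P pq≃0 i j l))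
    (λ p≈0 → p≄0 (≈P⇒≃P p≈0)) (λ q≈0 → q≄0 (≈P⇒≃P q≈0))

-- Rational functions

prodL-++ : ∀ ds es → prodL (ds ++ es) ≃P prodL ds ⊗ prodL es
prodL-++ []             es = Poly.sym (Poly.*-identityˡ _)
prodL-++ ((d , _) ∷ ds) es = Poly.trans (Poly.*-congˡ (prodL-++ ds es)) (Poly.sym (Poly.*-assoc _ _ _))

prodL-nonzero : ∀ ds → ¬ prodL ds ≃P con (+ 0)
prodL-nonzero []               1≃0 with ≃P⇒≈P 1≃0 0 0 0
... | ()
prodL-nonzero ((d , d≉0) ∷ ds) dD≃0 =
  poly-noZeroDivisors dD≃0 (λ d≃0 → d≉0 (≃P⇒≈P d≃0)) (prodL-nonzero ds)

⊗-cancelʳ : ∀ r {p q} → ¬ r ≃P con (+ 0) → p ⊗ r ≃P q ⊗ r → p ≃P q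
⊗-cancelʳ r {p} {q} r≄0 pr≃qr = begin
  p               ≈⟨ solve 2 (λ p q → p := q :+ (p :- q)) Poly.refl p q ⟩
  q ⊕ (p ⊕ neg q) ≈⟨ Poly.+-congˡ (poly-stable (poly-noZeroDivisors r[p-q]≃0 r≄0)) ⟩
  q ⊕ con (+ 0)   ≈⟨ Poly.+-identityʳ q ⟩
  q               ∎
  where
  open SetoidReasoning Poly.setoid
  open PolySolver
  r[p-q]≃0 : r ⊗ (p ⊕ neg q) ≃P con (+ 0)
  r[p-q]≃0 = begin
    r ⊗ (p ⊕ neg q)         ≈⟨ solve 3 (λ p q r → r :* (p :- q) := p :* r :- q :* r) Poly.refl p q r ⟩
    (p ⊗ r) ⊕ neg (q ⊗ r)   ≈⟨ Poly.+-congʳ pr≃qr ⟩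
    (q ⊗ r) ⊕ neg (q ⊗ r)   ≈⟨ Poly.-‿inverseʳ _ ⟩
    con (+ 0)               ∎

infix 4 _≃F_
record _≃F_ (f g : Frac) : Set where
  constructor cross-multiplied
  field cross : num f ⊗ prodL (den g) ≃P num g ⊗ prodL (den f)

≈F⇒≃F : ∀ {f g} → f ≈F g → f ≃F g
≈F⇒≃F f≈g = cross-multiplied (≈P⇒≃P f≈g)

≃F⇒≈F : ∀ {f g} → f ≃F g → f ≈F g
≃F⇒≈F (cross-multiplied f≃g) = ≃P⇒≈P f≃g

module FractionLaws where
  open SetoidReasoning Poly.setoid
  open PolySolver

  D : Frac → Expr
  D f = prodL (den f)

  ≃F-isEquivalence : IsEquivalence _≃F_
  ≃F-isEquivalence = record
    { refl  = cross-multiplied Poly.refl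
    ; sym   = λ { (cross-multiplied f≃g) → cross-multiplied (Poly.sym f≃g) }
    ; trans = ≃F-trans
    }
    where
    swap : ∀ x y z → (x ⊗ y) ⊗ z ≃P (x ⊗ z) ⊗ y
    swap = solve 3 (λ x y z → x :* y :* z := x :* z :* y) Poly.refl
    ≃F-trans : ∀ {f g h} → f ≃F g → g ≃F h → f ≃F h
    ≃F-trans {f} {g} {h} (cross-multiplied f≃g) (cross-multiplied g≃h) =
      cross-multiplied (⊗-cancelʳ (D g) (prodL-nonzero (den g)) (begin
        (num f ⊗ D h) ⊗ D g ≈⟨ swap _ _ _ ⟩
        (num f ⊗ D g) ⊗ D h ≈⟨ Poly.*-congʳ f≃g ⟩
        (num g ⊗ D f) ⊗ D h ≈⟨ swap _ _ _ ⟩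
        (num g ⊗ D h) ⊗ D f ≈⟨ Poly.*-congʳ g≃h ⟩
        (num h ⊗ D g) ⊗ D f ≈⟨ swap _ _ _ ⟩
        (num h ⊗ D f) ⊗ D g ∎))

  ≃F-setoid : Setoid _ _
  ≃F-setoid = record { isEquivalence = ≃F-isEquivalence }

  -- The denominator of a compound fraction is `prodL` of a concatenation, which the solver treats
  -- as an atom. Here `m / d` and `n / e` are the factored forms, and only `m ⊗ e ≃P n ⊗ d` is left
  -- to the solver.
  ≃F-from : ∀ {f g m d n e} → num f ≃P m → D f ≃P d → num g ≃P n → D g ≃P e → m ⊗ e ≃P n ⊗ d → f ≃F g
  ≃F-from {f} {g} {m} {d} {n} {e} f≃m Df≃d g≃n Dg≃e me≃nd = cross-multiplied (begin
    num f ⊗ D g ≈⟨ Poly.*-cong f≃m Dg≃e ⟩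
    m ⊗ e       ≈⟨ me≃nd ⟩
    n ⊗ d       ≈⟨ Poly.*-cong g≃n Df≃d ⟨
    num g ⊗ D f ∎)

  +F-cong : ∀ {f f′ g g′} → f ≃F f′ → g ≃F g′ → f +F g ≃F f′ +F g′
  +F-cong {f} {f′} {g} {g′} (cross-multiplied f≃f′) (cross-multiplied g≃g′) =
    ≃F-from Poly.refl (prodL-++ (den f) (den g)) Poly.refl (prodL-++ (den f′) (den g′)) (begin
      ((num f ⊗ D g) ⊕ (num g ⊗ D f)) ⊗ (D f′ ⊗ D g′)
        ≈⟨ solve 6 (λ n d m e d′ e′ → (n :* e :+ m :* d) :* (d′ :* e′) :=
                      n :* d′ :* (e :* e′) :+ m :* e′ :* (d :* d′))
             Poly.refl (num f) (D f) (num g) (D g) (D f′) (D g′) ⟩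
      ((num f ⊗ D f′) ⊗ (D g ⊗ D g′)) ⊕ ((num g ⊗ D g′) ⊗ (D f ⊗ D f′))
        ≈⟨ Poly.+-cong (Poly.*-congʳ f≃f′) (Poly.*-congʳ g≃g′) ⟩
      ((num f′ ⊗ D f) ⊗ (D g ⊗ D g′)) ⊕ ((num g′ ⊗ D g) ⊗ (D f ⊗ D f′))
        ≈⟨ solve 6 (λ n d m e d′ e′ → n :* d′ :* (e′ :* e) :+ m :* e′ :* (d′ :* d) :=
                      (n :* e :+ m :* d) :* (d′ :* e′))
             Poly.refl (num f′) (D f′) (num g′) (D g′) (D f) (D g) ⟩
      ((num f′ ⊗ D g′) ⊕ (num g′ ⊗ D f′)) ⊗ (D f ⊗ D g) ∎)

  *F-cong : ∀ {f f′ g g′} → f ≃F f′ → g ≃F g′ → f *F g ≃F f′ *F g′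
  *F-cong {f} {f′} {g} {g′} (cross-multiplied f≃f′) (cross-multiplied g≃g′) =
    ≃F-from Poly.refl (prodL-++ (den f) (den g)) Poly.refl (prodL-++ (den f′) (den g′)) (begin
      (num f ⊗ num g) ⊗ (D f′ ⊗ D g′)   ≈⟨ exchange _ _ _ _ ⟩
      (num f ⊗ D f′) ⊗ (num g ⊗ D g′)   ≈⟨ Poly.*-cong f≃f′ g≃g′ ⟩
      (num f′ ⊗ D f) ⊗ (num g′ ⊗ D g)   ≈⟨ exchange _ _ _ _ ⟩
      (num f′ ⊗ num g′) ⊗ (D f ⊗ D g)   ∎)
    where
    exchange : ∀ w x y z → (w ⊗ x) ⊗ (y ⊗ z) ≃P (w ⊗ y) ⊗ (x ⊗ z)
    exchange = solve 4 (λ w x y z → w :* x :* (y :* z) := w :* y :* (x :* z)) Poly.refl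

  -F-cong : ∀ {f g} → f ≃F g → -F f ≃F -F g
  -F-cong {f} {g} (cross-multiplied f≃g) = cross-multiplied (begin
    neg (num f) ⊗ D g   ≈⟨ neg-out _ _ ⟩
    neg (num f ⊗ D g)   ≈⟨ Poly.-‿cong f≃g ⟩
    neg (num g ⊗ D f)   ≈⟨ neg-out _ _ ⟨
    neg (num g) ⊗ D f   ∎)
    where
    neg-out : ∀ x y → neg x ⊗ y ≃P neg (x ⊗ y)
    neg-out = solve 2 (λ x y → (:- x) :* y := :- (x :* y)) Poly.refl

  prodL-++-++ : ∀ ds es fs → prodL (ds ++ es ++ fs) ≃P prodL ds ⊗ (prodL es ⊗ prodL fs)
  prodL-++-++ ds es fs = Poly.trans (prodL-++ ds (es ++ fs)) (Poly.*-congˡ (prodL-++ es fs))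

  prodL-[++]-++ : ∀ ds es fs → prodL ((ds ++ es) ++ fs) ≃P (prodL ds ⊗ prodL es) ⊗ prodL fs
  prodL-[++]-++ ds es fs = Poly.trans (prodL-++ (ds ++ es) fs) (Poly.*-congʳ (prodL-++ ds es))

  +F-assoc : ∀ f g h → (f +F g) +F h ≃F f +F (g +F h)
  +F-assoc f g h = ≃F-from
    (Poly.+-congˡ (Poly.*-congˡ (prodL-++ (den f) (den g))))
    (prodL-[++]-++ (den f) (den g) (den h))
    (Poly.+-congʳ (Poly.*-congˡ (prodL-++ (den g) (den h))))
    (prodL-++-++ (den f) (den g) (den h))
    (solve 6 (λ n d m e l c →
        ((n :* e :+ m :* d) :* c :+ l :* (d :* e)) :* (d :* (e :* c)) :=
        (n :* (e :* c) :+ (m :* c :+ l :* e) :* d) :* (d :* e :* c))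
      Poly.refl (num f) (D f) (num g) (D g) (num h) (D h))

  +F-comm : ∀ f g → f +F g ≃F g +F f
  +F-comm f g = ≃F-from
    Poly.refl (prodL-++ (den f) (den g)) Poly.refl (prodL-++ (den g) (den f))
    (solve 4 (λ n d m e → (n :* e :+ m :* d) :* (e :* d) := (m :* d :+ n :* e) :* (d :* e))
      Poly.refl (num f) (D f) (num g) (D g))

  +F-identityˡ : ∀ f → 0F +F f ≃F f
  +F-identityˡ f = cross-multiplied (Poly.*-congʳ (begin
    (con (+ 0) ⊗ D f) ⊕ (num f ⊗ con (+ 1)) ≈⟨ Poly.+-cong (Poly.zeroˡ _) (Poly.*-identityʳ _) ⟩
    con (+ 0) ⊕ num f                       ≈⟨ Poly.+-identityˡ _ ⟩
    num f                                   ∎))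

  -F-inverseˡ : ∀ f → (-F f) +F f ≃F 0F
  -F-inverseˡ f = cross-multiplied (begin
    ((neg (num f) ⊗ D f) ⊕ (num f ⊗ D f)) ⊗ con (+ 1)
      -- The 1 of the goal is passed as an atom `i`, because the solver's own constant 1 denotes
      -- `1# + 0#`; its constant 0 does denote `0#`.
      ≈⟨ solve 3 (λ n d i → ((:- n) :* d :+ n :* d) :* i := con (+ 0)) Poly.refl (num f) (D f) (con (+ 1)) ⟩
    con (+ 0)
      ≈⟨ Poly.zeroˡ _ ⟨
    con (+ 0) ⊗ prodL (den f ++ den f) ∎)

  *F-assoc : ∀ f g h → (f *F g) *F h ≃F f *F (g *F h)
  *F-assoc f g h = ≃F-from
    Poly.refl (prodL-[++]-++ (den f) (den g) (den h)) Poly.refl (prodL-++-++ (den f) (den g) (den h))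
    (solve 6 (λ n d m e l c → n :* m :* l :* (d :* (e :* c)) := n :* (m :* l) :* (d :* e :* c))
      Poly.refl (num f) (D f) (num g) (D g) (num h) (D h))

  *F-comm : ∀ f g → f *F g ≃F g *F f
  *F-comm f g = ≃F-from
    Poly.refl (prodL-++ (den f) (den g)) Poly.refl (prodL-++ (den g) (den f))
    (solve 4 (λ n d m e → n :* m :* (e :* d) := m :* n :* (d :* e)) Poly.refl (num f) (D f) (num g) (D g))

  *F-identityˡ : ∀ f → 1F *F f ≃F f
  *F-identityˡ f = cross-multiplied (Poly.*-congʳ (Poly.*-identityˡ _))

  *F-distribˡ-+F : ∀ f g h → f *F (g +F h) ≃F f *F g +F f *F h
  *F-distribˡ-+F f g h = ≃F-from
    Poly.refl
    (prodL-++-++ (den f) (den g) (den h))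
    (Poly.+-cong (Poly.*-congˡ (prodL-++ (den f) (den h))) (Poly.*-congˡ (prodL-++ (den f) (den g))))
    (Poly.trans (prodL-++ (den f ++ den g) (den f ++ den h))
      (Poly.*-cong (prodL-++ (den f) (den g)) (prodL-++ (den f) (den h))))
    (solve 6 (λ n d m e l c →
        n :* (m :* c :+ l :* e) :* (d :* e :* (d :* c)) :=
        (n :* m :* (d :* c) :+ n :* l :* (d :* e)) :* (d :* (e :* c)))
      Poly.refl (num f) (D f) (num g) (D g) (num h) (D h))

fracRing : CommutativeRing _ _
fracRing = record
  { Carrier = Frac
  ; _≈_     = _≃F_
  ; _+_     = _+F_
  ; _*_     = _*F_
  ; -_      = -F_
  ; 0#      = 0F
  ; 1#      = 1F
  ; isCommutativeRing = record
    { isRing = record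
      { +-isAbelianGroup = record
        { isGroup = record
          { isMonoid = record
            { isSemigroup = record
              { isMagma = record { isEquivalence = ≃F-isEquivalence ; ∙-cong = +F-cong }
              ; assoc   = +F-assoc
              }
            ; identity = comm∧idˡ⇒id +F-comm +F-identityˡ
            }
          ; inverse = comm∧invˡ⇒inv +F-comm -F-inverseˡ
          ; ⁻¹-cong = -F-cong
          }
        ; comm = +F-comm
        }
      ; *-cong     = *F-cong
      ; *-assoc    = *F-assoc
      ; *-identity = comm∧idˡ⇒id *F-comm *F-identityˡ
      ; distrib    = comm∧distrˡ⇒distr +F-cong *F-comm *F-distribˡ-+F
      }
    ; *-comm = *F-comm
    }
  }
  where
  open FractionLaws
  open Consequences ≃F-setoid

module F = CommutativeRing fracRing

↑-injective : ∀ {p q} → ↑ p ≃F ↑ q → p ≃P q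
↑-injective (cross-multiplied p≃q) =
  Poly.trans (Poly.sym (Poly.*-identityʳ _)) (Poly.trans p≃q (Poly.*-identityʳ _))

↑-cong : ∀ {p q} → p ≃P q → ↑ p ≃F ↑ q
↑-cong p≃q = cross-multiplied (Poly.*-congʳ p≃q)

↑-⊕ : ∀ p q → ↑ (p ⊕ q) ≃F ↑ p +F ↑ q
↑-⊕ p q = cross-multiplied (Poly.*-congʳ (Poly.sym (Poly.+-cong (Poly.*-identityʳ _) (Poly.*-identityʳ _))))

num≃0⇒≃0 : ∀ f → num f ≃P con (+ 0) → f ≃F 0F
num≃0⇒≃0 f nf≃0 = cross-multiplied (Poly.trans (Poly.*-identityʳ _) (Poly.trans nf≃0 (Poly.sym (Poly.zeroˡ _))))

*F-cancel-0 : ∀ f g → f *F g ≃F 0F → ¬ f ≃F 0F → g ≃F 0F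
*F-cancel-0 f g (cross-multiplied fg≃0) f≄0 =
  num≃0⇒≃0 g (poly-stable (poly-noZeroDivisors
    (Poly.trans (Poly.sym (Poly.*-identityʳ _)) (Poly.trans fg≃0 (Poly.zeroˡ _)))
    (λ nf≃0 → f≄0 (num≃0⇒≃0 f nf≃0))))

-- The Markov equation and matrix mutation as identities in a commutative ring

module MarkovIdentities {r ℓ} (R : CommutativeRing r ℓ) where
  open CommutativeRing R
  open import Algebra.Properties.Group +-group using (x≈y⇒x∙y⁻¹≈ε; x∙y⁻¹≈ε⇒x≈y)
  open import Relation.Binary.Reasoning.Setoid setoid
  open IntegerCoefficientSolver R

  exchange-poly : (k x y : Carrier) → Carrier
  exchange-poly k x y = x * x + k * x * y + y * y

  markov : (M k₁ k₂ k₃ a b c : Carrier) → Carrier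
  markov M k₁ k₂ k₃ a b c =
    a * a + b * b + c * c + k₁ * b * c + k₂ * a * c + k₃ * a * b - M * a * b * c

  markov-swap₁₂ : ∀ M k₁ k₂ k₃ a b c → markov M k₁ k₂ k₃ a b c ≈ markov M k₂ k₁ k₃ b a c
  markov-swap₁₂ = solve 7 (λ M k₁ k₂ k₃ a b c →
    a :* a :+ b :* b :+ c :* c :+ k₁ :* b :* c :+ k₂ :* a :* c :+ k₃ :* a :* b :- M :* a :* b :* c :=
    b :* b :+ a :* a :+ c :* c :+ k₂ :* a :* c :+ k₁ :* b :* c :+ k₃ :* b :* a :- M :* b :* a :* c) refl

  markov-swap₂₃ : ∀ M k₁ k₂ k₃ a b c → markov M k₁ k₂ k₃ a b c ≈ markov M k₁ k₃ k₂ a c b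
  markov-swap₂₃ = solve 7 (λ M k₁ k₂ k₃ a b c →
    a :* a :+ b :* b :+ c :* c :+ k₁ :* b :* c :+ k₂ :* a :* c :+ k₃ :* a :* b :- M :* a :* b :* c :=
    a :* a :+ c :* c :+ b :* b :+ k₁ :* c :* b :+ k₃ :* a :* b :+ k₂ :* a :* c :- M :* a :* c :* b) refl

  exchange-poly-comm : ∀ k x y → exchange-poly k x y ≈ exchange-poly k y x
  exchange-poly-comm = solve 3 (λ k x y → x :* x :+ k :* x :* y :+ y :* y := y :* y :+ k :* y :* x :+ x :* x) refl

  exchange-poly-cong : ∀ k {x x′ y y′} → x ≈ x′ → y ≈ y′ → exchange-poly k x y ≈ exchange-poly k x′ y′
  exchange-poly-cong k x≈ y≈ = +-cong (+-cong (*-cong x≈ x≈) (*-cong (*-congˡ x≈) y≈)) (*-cong y≈ y≈)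

  markov-cong : ∀ M k₁ k₂ k₃ {a a′ b b′ c c′} → a ≈ a′ → b ≈ b′ → c ≈ c′ →
                markov M k₁ k₂ k₃ a b c ≈ markov M k₁ k₂ k₃ a′ b′ c′
  markov-cong M k₁ k₂ k₃ a≈ b≈ c≈ =
    +-cong (+-cong (+-cong (+-cong (+-cong (+-cong
      (*-cong a≈ a≈) (*-cong b≈ b≈)) (*-cong c≈ c≈))
      (*-cong (*-congˡ b≈) c≈)) (*-cong (*-congˡ a≈) c≈)) (*-cong (*-congˡ a≈) b≈))
      (-‿cong (*-cong (*-cong (*-congˡ a≈) b≈) c≈))

  -- The exchange polynomial is homogeneous of degree 2, so over the common denominator `D_b * D_c`
  -- of `b` and `c` its value acquires the square of that denominator; dividing by `a` turns `Nₐ`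
  -- over `Dₐ` upside down. The new numerator and denominator arise from the old ones without
  -- subtraction, as the comparison of orders requires.
  exchange-fraction : ∀ k a b c a′ Nₐ Dₐ N_b D_b N_c D_c →
    a * Dₐ ≈ Nₐ → b * D_b ≈ N_b → c * D_c ≈ N_c → a′ * a ≈ exchange-poly k b c →
    a′ * ((D_b * D_c) * (D_b * D_c) * Nₐ) ≈ exchange-poly k (N_b * D_c) (N_c * D_b) * Dₐ
  exchange-fraction k a b c a′ Nₐ Dₐ N_b D_b N_c D_c a≈ b≈ c≈ exch = begin
    a′ * ((D_b * D_c) * (D_b * D_c) * Nₐ)
      ≈⟨ *-congˡ (*-congˡ a≈) ⟨
    a′ * ((D_b * D_c) * (D_b * D_c) * (a * Dₐ))
      ≈⟨ solve 5 (λ a′ a b c d → a′ :* ((b :* c) :* (b :* c) :* (a :* d)) := (a′ :* a) :* ((b :* c) :* (b :* c)) :* d)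
           refl a′ a D_b D_c Dₐ ⟩
    (a′ * a) * ((D_b * D_c) * (D_b * D_c)) * Dₐ
      ≈⟨ *-congʳ (*-congʳ exch) ⟩
    exchange-poly k b c * ((D_b * D_c) * (D_b * D_c)) * Dₐ
      ≈⟨ *-congʳ (solve 5 (λ k b c e f →
           (b :* b :+ k :* b :* c :+ c :* c) :* ((e :* f) :* (e :* f)) :=
           (b :* e :* f) :* (b :* e :* f) :+ k :* (b :* e :* f) :* (c :* f :* e) :+ (c :* f :* e) :* (c :* f :* e))
           refl k b c D_b D_c) ⟩
    exchange-poly k (b * D_b * D_c) (c * D_c * D_b) * Dₐ
      ≈⟨ *-congʳ (exchange-poly-cong k (*-congʳ b≈) (*-congʳ c≈)) ⟩
    exchange-poly k (N_b * D_c) (N_c * D_b) * Dₐ ∎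

  module _ (M k₁ k₂ k₃ a b c a′ : Carrier)
           (exchange : a′ * a ≈ exchange-poly k₁ b c) (markov≈0 : markov M k₁ k₂ k₃ a b c ≈ 0#) where

    private
      exchange≈0 : a′ * a - exchange-poly k₁ b c ≈ 0#
      exchange≈0 = x≈y⇒x∙y⁻¹≈ε exchange

    -- The Markov equation is monic quadratic in a; a and a′ are its two roots,
    -- and vieta ≈ 0 says that their sum is right.
    vieta : Carrier
    vieta = a + a′ + k₂ * c + k₃ * b - M * b * c

    -- The exchange relation trades the terms of the quadratic free of `a` for `a′ * a`, which
    -- leaves a multiple of `a`. Cancelling `a` is not possible in a general commutative ring,
    -- whence the separate hypothesis of `markov-mutate`.
    a*vieta≈0 : a * vieta ≈ 0#
    a*vieta≈0 = begin
      a * vieta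
        ≈⟨ solve 8 (λ M k₁ k₂ k₃ a b c a′ →
             a :* (a :+ a′ :+ k₂ :* c :+ k₃ :* b :- M :* b :* c) :=
             (a :* a :+ b :* b :+ c :* c :+ k₁ :* b :* c :+ k₂ :* a :* c :+ k₃ :* a :* b :- M :* a :* b :* c)
               :+ (a′ :* a :- (b :* b :+ k₁ :* b :* c :+ c :* c))) refl M k₁ k₂ k₃ a b c a′ ⟩
      markov M k₁ k₂ k₃ a b c + (a′ * a - exchange-poly k₁ b c)
        ≈⟨ +-cong markov≈0 exchange≈0 ⟩
      0# + 0#
        ≈⟨ +-identityˡ _ ⟩
      0# ∎

    markov-mutate : vieta ≈ 0# → markov M k₁ k₂ k₃ a′ b c ≈ 0#
    markov-mutate vieta≈0 = begin
      markov M k₁ k₂ k₃ a′ b c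
        ≈⟨ solve 8 (λ M k₁ k₂ k₃ a b c a′ →
             a′ :* a′ :+ b :* b :+ c :* c :+ k₁ :* b :* c :+ k₂ :* a′ :* c :+ k₃ :* a′ :* b :- M :* a′ :* b :* c :=
             a′ :* (a :+ a′ :+ k₂ :* c :+ k₃ :* b :- M :* b :* c)
               :- (a′ :* a :- (b :* b :+ k₁ :* b :* c :+ c :* c))) refl M k₁ k₂ k₃ a b c a′ ⟩
      a′ * vieta - (a′ * a - exchange-poly k₁ b c)
        ≈⟨ +-cong (*-congˡ vieta≈0) (-‿cong exchange≈0) ⟩
      a′ * 0# - 0#
        ≈⟨ solve 1 (λ x → x :* con (+ 0) :- con (+ 0) := con (+ 0)) refl a′ ⟩
      0# ∎

  -- With Q = P R − S_Q, the matrix P Q = P² R − P S_Q is rewritten through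
  -- Cayley–Hamilton, P² = tr(P) P − 1.  Here s and s′ are the diagonal entries of S_Q and S_R.
  record MatrixMutation : Set (r ⊔ ℓ) where
    field
      M kₐ k_b k_c p₁₁ a p₂₁ p₂₂ q₁₁ b q₂₁ q₂₂ r₁₁ c r₂₁ r₂₂ s s′ : Carrier
      s≈       : s ≈ k_b
      s′≈      : s′ ≈ k_c
      q₁₁≈     : q₁₁ ≈ p₁₁ * r₁₁ + a * r₂₁ - s
      b≈       : b ≈ p₁₁ * c + a * r₂₂ - 0#
      q₂₁≈     : q₂₁ ≈ p₂₁ * r₁₁ + p₂₂ * r₂₁ - s * M
      q₂₂≈     : q₂₂ ≈ p₂₁ * c + p₂₂ * r₂₂ - s
      trP      : p₁₁ + p₂₂ ≈ M * a - kₐ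
      trQ      : q₁₁ + q₂₂ ≈ M * b - k_b
      trR      : r₁₁ + r₂₂ ≈ M * c - k_c
      detP     : p₁₁ * p₂₂ - a * p₂₁ ≈ 1#
      detQ     : q₁₁ * q₂₂ - b * q₂₁ ≈ 1#
      markov≈0 : markov M kₐ k_b k_c a b c ≈ 0#

    x₁₁ x₁₂ x₂₁ x₂₂ : Carrier
    x₁₁ = p₁₁ * q₁₁ + a * q₂₁
    x₁₂ = p₁₁ * b + a * q₂₂
    x₂₁ = p₂₁ * q₁₁ + p₂₂ * q₂₁
    x₂₂ = p₂₁ * b + p₂₂ * q₂₂

    x₁₂≈ : x₁₂ ≈ (M * a - kₐ) * b - c - k_b * a
    x₁₂≈ = begin
      p₁₁ * b + a * q₂₂
        ≈⟨ +-cong (*-congˡ b≈) (*-congˡ q₂₂≈) ⟩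
      p₁₁ * (p₁₁ * c + a * r₂₂ - 0#) + a * (p₂₁ * c + p₂₂ * r₂₂ - s)
        -- The right-hand side is the (1,2)-entry of tr(P) P R - det(P) R - P S_Q; as the
        -- (1,2)-entry of S_Q is 0, the last term contributes only `s * a`.
        ≈⟨ solve 7 (λ p₁₁ a p₂₁ p₂₂ c r₂₂ s →
             p₁₁ :* (p₁₁ :* c :+ a :* r₂₂ :- con (+ 0)) :+ a :* (p₂₁ :* c :+ p₂₂ :* r₂₂ :- s) :=
             (p₁₁ :+ p₂₂) :* (p₁₁ :* c :+ a :* r₂₂ :- con (+ 0)) :- (p₁₁ :* p₂₂ :- a :* p₂₁) :* c :- s :* a)
             refl p₁₁ a p₂₁ p₂₂ c r₂₂ s ⟩
      (p₁₁ + p₂₂) * (p₁₁ * c + a * r₂₂ - 0#) - (p₁₁ * p₂₂ - a * p₂₁) * c - s * a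
        ≈⟨ +-cong (+-cong (*-cong trP (sym b≈)) (-‿cong (trans (*-congʳ detP) (*-identityˡ c)))) (-‿cong (*-congʳ s≈)) ⟩
      (M * a - kₐ) * b - c - k_b * a ∎

    -- For the adjugate, P + adj(P) = tr(P) and adj(P) Q = R - adj(P) S_Q. Hence tr(P Q) = tr(P)
    -- tr(Q) - tr(R) + tr(adj(P) S_Q), and the last trace is `s * (p₁₁ + p₂₂ - M * a)`. The sign of
    -- `k_c` is opposite to that in a CGC matrix; subtracting S_R, of trace 2 `k_c`, corrects it.
    trX : x₁₁ + x₂₂ ≈ M * x₁₂ + k_c
    trX = begin
      p₁₁ * q₁₁ + a * q₂₁ + (p₂₁ * b + p₂₂ * q₂₂)
        ≈⟨ +-cong (+-congˡ (*-congˡ q₂₁≈)) (+-congʳ (*-congˡ b≈)) ⟩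
      p₁₁ * q₁₁ + a * (p₂₁ * r₁₁ + p₂₂ * r₂₁ - s * M) + (p₂₁ * (p₁₁ * c + a * r₂₂ - 0#) + p₂₂ * q₂₂)
        ≈⟨ solve 12 (λ M p₁₁ a p₂₁ p₂₂ q₁₁ q₂₂ r₁₁ c r₂₁ r₂₂ s →
             p₁₁ :* q₁₁ :+ a :* (p₂₁ :* r₁₁ :+ p₂₂ :* r₂₁ :- s :* M)
               :+ (p₂₁ :* (p₁₁ :* c :+ a :* r₂₂ :- con (+ 0)) :+ p₂₂ :* q₂₂) :=
             p₁₁ :* q₁₁ :+ p₂₂ :* q₂₂ :+ p₂₂ :* (p₁₁ :* r₁₁ :+ a :* r₂₁ :- s)
               :+ p₁₁ :* (p₂₁ :* c :+ p₂₂ :* r₂₂ :- s)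
               :- (p₁₁ :* p₂₂ :- a :* p₂₁) :* (r₁₁ :+ r₂₂) :+ s :* (p₁₁ :+ p₂₂ :- M :* a))
             refl M p₁₁ a p₂₁ p₂₂ q₁₁ q₂₂ r₁₁ c r₂₁ r₂₂ s ⟩
      p₁₁ * q₁₁ + p₂₂ * q₂₂ + p₂₂ * (p₁₁ * r₁₁ + a * r₂₁ - s) + p₁₁ * (p₂₁ * c + p₂₂ * r₂₂ - s)
        - (p₁₁ * p₂₂ - a * p₂₁) * (r₁₁ + r₂₂) + s * (p₁₁ + p₂₂ - M * a)
        ≈⟨ +-cong (+-cong (+-cong (+-congˡ (*-congˡ (sym q₁₁≈))) (*-congˡ (sym q₂₂≈)))
             (-‿cong (trans (*-congʳ detP) (*-identityˡ _)))) (*-congʳ s≈) ⟩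
      p₁₁ * q₁₁ + p₂₂ * q₂₂ + p₂₂ * q₁₁ + p₁₁ * q₂₂ - (r₁₁ + r₂₂) + k_b * (p₁₁ + p₂₂ - M * a)
        ≈⟨ +-congʳ (+-congʳ (solve 4 (λ p₁₁ p₂₂ q₁₁ q₂₂ →
             p₁₁ :* q₁₁ :+ p₂₂ :* q₂₂ :+ p₂₂ :* q₁₁ :+ p₁₁ :* q₂₂ := (p₁₁ :+ p₂₂) :* (q₁₁ :+ q₂₂))
             refl p₁₁ p₂₂ q₁₁ q₂₂)) ⟩
      (p₁₁ + p₂₂) * (q₁₁ + q₂₂) - (r₁₁ + r₂₂) + k_b * (p₁₁ + p₂₂ - M * a)
        ≈⟨ +-cong (+-cong (*-cong trP trQ) (-‿cong trR)) (*-congˡ (+-congʳ trP)) ⟩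
      (M * a - kₐ) * (M * b - k_b) - (M * c - k_c) + k_b * (M * a - kₐ - M * a)
        ≈⟨ solve 7 (λ M kₐ k_b k_c a b c →
             (M :* a :- kₐ) :* (M :* b :- k_b) :- (M :* c :- k_c) :+ k_b :* (M :* a :- kₐ :- M :* a) :=
             M :* ((M :* a :- kₐ) :* b :- c :- k_b :* a) :+ k_c)
             refl M kₐ k_b k_c a b c ⟩
      M * ((M * a - kₐ) * b - c - k_b * a) + k_c
        ≈⟨ +-congʳ (*-congˡ x₁₂≈) ⟨
      M * x₁₂ + k_c ∎

    detX : x₁₁ * x₂₂ - x₁₂ * x₂₁ ≈ 1#
    detX = begin
      x₁₁ * x₂₂ - x₁₂ * x₂₁
        ≈⟨ solve 8 (λ p₁₁ a p₂₁ p₂₂ q₁₁ b q₂₁ q₂₂ →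
             (p₁₁ :* q₁₁ :+ a :* q₂₁) :* (p₂₁ :* b :+ p₂₂ :* q₂₂)
               :- (p₁₁ :* b :+ a :* q₂₂) :* (p₂₁ :* q₁₁ :+ p₂₂ :* q₂₁) :=
             (p₁₁ :* p₂₂ :- a :* p₂₁) :* (q₁₁ :* q₂₂ :- b :* q₂₁))
             refl p₁₁ a p₂₁ p₂₂ q₁₁ b q₂₁ q₂₂ ⟩
      (p₁₁ * p₂₂ - a * p₂₁) * (q₁₁ * q₂₂ - b * q₂₁)
        ≈⟨ *-cong detP detQ ⟩
      1# * 1#
        ≈⟨ *-identityˡ 1# ⟩
      1# ∎

    entry₁₂ : (x₁₂ - 0#) * c ≈ exchange-poly k_c a b
    entry₁₂ = x∙y⁻¹≈ε⇒x≈y _ _ (begin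
      (x₁₂ - 0#) * c - exchange-poly k_c a b
        ≈⟨ +-congʳ (*-congʳ (+-congʳ x₁₂≈)) ⟩
      ((M * a - kₐ) * b - c - k_b * a - 0#) * c - exchange-poly k_c a b
        ≈⟨ solve 7 (λ M kₐ k_b k_c a b c →
             ((M :* a :- kₐ) :* b :- c :- k_b :* a :- con (+ 0)) :* c :- (a :* a :+ k_c :* a :* b :+ b :* b) :=
             :- (a :* a :+ b :* b :+ c :* c :+ kₐ :* b :* c :+ k_b :* a :* c :+ k_c :* a :* b :- M :* a :* b :* c))
             refl M kₐ k_b k_c a b c ⟩
      - markov M kₐ k_b k_c a b c
        ≈⟨ -‿cong markov≈0 ⟩
      - 0#
        ≈⟨ solve 0 (:- con (+ 0) := con (+ 0)) refl ⟩
      0# ∎)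

    trace : (x₁₁ - s′) + (x₂₂ - s′) ≈ M * (x₁₂ - 0#) - k_c
    trace = begin
      (x₁₁ - s′) + (x₂₂ - s′)
        ≈⟨ solve 3 (λ x y s → (x :- s) :+ (y :- s) := x :+ y :- (s :+ s)) refl x₁₁ x₂₂ s′ ⟩
      x₁₁ + x₂₂ - (s′ + s′)
        ≈⟨ +-cong trX (-‿cong (+-cong s′≈ s′≈)) ⟩
      M * x₁₂ + k_c - (k_c + k_c)
        ≈⟨ solve 3 (λ M x k → M :* x :+ k :- (k :+ k) := M :* (x :- con (+ 0)) :- k) refl M x₁₂ k_c ⟩
      M * (x₁₂ - 0#) - k_c ∎

    -- Subtracting `s′` times the matrix with rows (1, 0) and (`M`, 1) changes the determinant by
    -- `s′ * (s′ - (x₁₁ + x₂₂ - M * x₁₂))`. By `trX` the inner difference is `k_c`, which is also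
    -- the value of `s′`.
    determinant : (x₁₁ - s′) * (x₂₂ - s′) - (x₁₂ - 0#) * (x₂₁ - s′ * M) ≈ 1#
    determinant = begin
      (x₁₁ - s′) * (x₂₂ - s′) - (x₁₂ - 0#) * (x₂₁ - s′ * M)
        ≈⟨ solve 6 (λ M x₁₁ x₁₂ x₂₁ x₂₂ s →
             (x₁₁ :- s) :* (x₂₂ :- s) :- (x₁₂ :- con (+ 0)) :* (x₂₁ :- s :* M) :=
             (x₁₁ :* x₂₂ :- x₁₂ :* x₂₁) :+ s :* (s :- (x₁₁ :+ x₂₂ :- M :* x₁₂)))
             refl M x₁₁ x₁₂ x₂₁ x₂₂ s′ ⟩
      (x₁₁ * x₂₂ - x₁₂ * x₂₁) + s′ * (s′ - (x₁₁ + x₂₂ - M * x₁₂))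
        ≈⟨ +-cong detX (*-congˡ (+-cong s′≈ (-‿cong (+-congʳ trX)))) ⟩
      1# + s′ * (k_c - (M * x₁₂ + k_c - M * x₁₂))
        ≈⟨ solve 5 (λ i s k M x → i :+ s :* (k :- (M :* x :+ k :- M :* x)) := i) refl 1# s′ k_c M x₁₂ ⟩
      1# ∎

-- Orders of polynomials with nonnegative coefficients

sumUpTo-zero : ∀ n {f} → (∀ a → a ℕ.≤ n → f a ≡ + 0) → sumUpTo n f ≡ + 0
sumUpTo-zero zero    f≡0 = f≡0 0 z≤n
sumUpTo-zero (suc n) f≡0 =
  ≡.cong₂ ℤ._+_ (sumUpTo-zero n λ a a≤n → f≡0 a (ℕ.m≤n⇒m≤1+n a≤n)) (f≡0 (suc n) ℕ.≤-refl)

sumUpTo-nonneg : ∀ n {f} → (∀ a → + 0 ℤ.≤ f a) → + 0 ℤ.≤ sumUpTo n f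
sumUpTo-nonneg zero    0≤f = 0≤f 0
sumUpTo-nonneg (suc n) 0≤f = ℤ.+-mono-≤ (sumUpTo-nonneg n 0≤f) (0≤f (suc n))

term≤sumUpTo : ∀ {n a f} → (∀ a → + 0 ℤ.≤ f a) → a ℕ.≤ n → f a ℤ.≤ sumUpTo n f
term≤sumUpTo {zero}          0≤f z≤n = ℤ.≤-refl
term≤sumUpTo {suc n} {a} {f} 0≤f a≤1+n with ℕ.m≤n⇒m<n∨m≡n a≤1+n
... | inj₁ (s≤s a≤n) = ≡.subst (ℤ._≤ sumUpTo (suc n) f) (ℤ.+-identityʳ (f a))
                         (ℤ.+-mono-≤ (term≤sumUpTo 0≤f a≤n) (0≤f (suc n)))
... | inj₂ ≡.refl    = ≡.subst (ℤ._≤ sumUpTo (suc n) f) (ℤ.+-identityˡ (f (suc n)))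
                         (ℤ.+-mono-≤ (sumUpTo-nonneg n 0≤f) (ℤ.≤-refl {f (suc n)}))

*-nonneg : ∀ {x y} → + 0 ℤ.≤ x → + 0 ℤ.≤ y → + 0 ℤ.≤ x ℤ.* y
*-nonneg {+ m} {+ n} _ _ = ≡.subst (+ 0 ℤ.≤_) (ℤ.pos-* m n) (+≤+ z≤n)

*-pos : ∀ {x y} → + 0 ℤ.< x → + 0 ℤ.< y → + 0 ℤ.< x ℤ.* y
*-pos {+ suc m} {+ suc n} _ _ = +<+ (s≤s z≤n)
*-pos {+ zero}  (+<+ ())
*-pos {+ suc m} {+ zero} _ (+<+ ())

ind0-nonneg : ∀ i → + 0 ℤ.≤ ind0 i
ind0-nonneg zero    = +≤+ z≤n
ind0-nonneg (suc i) = +≤+ z≤n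

exponent : Fin 3 → ℕ → ℕ → ℕ → ℕ
exponent zero             i j l = i
exponent (suc zero)       i j l = j
exponent (suc (suc zero)) i j l = l

exponent-split : ∀ d {i j l a b c} → a ℕ.≤ i → b ℕ.≤ j → c ℕ.≤ l →
                 exponent d a b c ℕ.+ exponent d (i ℕ.∸ a) (j ℕ.∸ b) (l ℕ.∸ c) ≡ exponent d i j l
exponent-split zero             a≤i b≤j c≤l = ℕ.m+[n∸m]≡n a≤i
exponent-split (suc zero)       a≤i b≤j c≤l = ℕ.m+[n∸m]≡n b≤j
exponent-split (suc (suc zero)) a≤i b≤j c≤l = ℕ.m+[n∸m]≡n c≤l

exponent-+ : ∀ d i j l i′ j′ l′ →
             exponent d (i ℕ.+ i′) (j ℕ.+ j′) (l ℕ.+ l′) ≡ exponent d i j l ℕ.+ exponent d i′ j′ l′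
exponent-+ zero             i j l i′ j′ l′ = ≡.refl
exponent-+ (suc zero)       i j l i′ j′ l′ = ≡.refl
exponent-+ (suc (suc zero)) i j l i′ j′ l′ = ≡.refl

m+n<o+p⇒m<o∨n<p : ∀ {m n} o p → m ℕ.+ n ℕ.< o ℕ.+ p → m ℕ.< o ⊎ n ℕ.< p
m+n<o+p⇒m<o∨n<p {m} {n} o p m+n<o+p with m ℕ.<? o
... | yes m<o = inj₁ m<o
... | no  m≮o = inj₂ (ℕ.≰⇒> λ p≤n → ℕ.<⇒≱ m+n<o+p (ℕ.+-mono-≤ (ℕ.≮⇒≥ m≮o) p≤n))

-- A lower bound for the order, kept apart from `HasOrder` because the summand k u v of an exchange
-- polynomial may be 0 and then has no order.
record NonNegFrom (d : Fin 3) (p : Expr) (n : ℕ) : Set where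
  field
    nonneg : ∀ i j l → + 0 ℤ.≤ coeff p i j l
    below  : ∀ i j l → exponent d i j l ℕ.< n → coeff p i j l ≡ + 0
open NonNegFrom

-- p has nonnegative coefficients and is exactly divisible by the n-th power of x_d.
record HasOrder (d : Fin 3) (p : Expr) (n : ℕ) : Set where
  field
    nonNegFrom : NonNegFrom d p n
    {i₀ j₀ l₀} : ℕ
    attained   : exponent d i₀ j₀ l₀ ≡ n
    positive   : + 0 ℤ.< coeff p i₀ j₀ l₀
open HasOrder

module _ {d : Fin 3} where

  nonNegFrom-weaken : ∀ {p m n} → m ℕ.≤ n → NonNegFrom d p n → NonNegFrom d p m
  nonNegFrom-weaken m≤n p≥ .nonneg = nonneg p≥
  nonNegFrom-weaken m≤n p≥ .below i j l e<m = below p≥ i j l (ℕ.≤-trans e<m m≤n)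

  con-nonNegFrom : ∀ k → NonNegFrom d (con (+ k)) 0
  con-nonNegFrom k .nonneg i j l =
    *-nonneg (*-nonneg (*-nonneg {+ k} (+≤+ z≤n) (ind0-nonneg i)) (ind0-nonneg j)) (ind0-nonneg l)
  con-nonNegFrom k .below i j l ()

  ⊕-nonNegFrom : ∀ {p q n} → NonNegFrom d p n → NonNegFrom d q n → NonNegFrom d (p ⊕ q) n
  ⊕-nonNegFrom p≥ q≥ .nonneg i j l = ℤ.+-mono-≤ (nonneg p≥ i j l) (nonneg q≥ i j l)
  ⊕-nonNegFrom p≥ q≥ .below i j l e<n = ≡.cong₂ ℤ._+_ (below p≥ i j l e<n) (below q≥ i j l e<n)

  ⊗-nonNegFrom : ∀ {p q m n} → NonNegFrom d p m → NonNegFrom d q n → NonNegFrom d (p ⊗ q) (m ℕ.+ n)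
  ⊗-nonNegFrom p≥ q≥ .nonneg i j l =
    sumUpTo-nonneg i λ a → sumUpTo-nonneg j λ b → sumUpTo-nonneg l λ c →
      *-nonneg (nonneg p≥ a b c) (nonneg q≥ (i ℕ.∸ a) (j ℕ.∸ b) (l ℕ.∸ c))
  ⊗-nonNegFrom {p} {q} {m} {n} p≥ q≥ .below i j l e<m+n =
    sumUpTo-zero i λ a a≤i → sumUpTo-zero j λ b b≤j → sumUpTo-zero l λ c c≤l → term a b c a≤i b≤j c≤l
    where
    term : ∀ a b c → a ℕ.≤ i → b ℕ.≤ j → c ℕ.≤ l →
           coeff p a b c ℤ.* coeff q (i ℕ.∸ a) (j ℕ.∸ b) (l ℕ.∸ c) ≡ + 0
    term a b c a≤i b≤j c≤l
      with m+n<o+p⇒m<o∨n<p m n (≡.subst (ℕ._< m ℕ.+ n) (≡.sym (exponent-split d a≤i b≤j c≤l)) e<m+n)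
    ... | inj₁ e<m rewrite below p≥ a b c e<m = ≡.refl
    ... | inj₂ e<n rewrite below q≥ (i ℕ.∸ a) (j ℕ.∸ b) (l ℕ.∸ c) e<n = ℤ.*-zeroʳ (coeff p a b c)

  ⊕-hasOrderˡ : ∀ {p q n} → HasOrder d p n → NonNegFrom d q n → HasOrder d (p ⊕ q) n
  ⊕-hasOrderˡ p≐ q≥ .nonNegFrom = ⊕-nonNegFrom (nonNegFrom p≐) q≥
  ⊕-hasOrderˡ p≐ q≥ .i₀ = i₀ p≐
  ⊕-hasOrderˡ p≐ q≥ .j₀ = j₀ p≐
  ⊕-hasOrderˡ p≐ q≥ .l₀ = l₀ p≐
  ⊕-hasOrderˡ p≐ q≥ .attained = attained p≐
  ⊕-hasOrderˡ p≐ q≥ .positive = ℤ.+-mono-<-≤ (positive p≐) (nonneg q≥ _ _ _)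

  ⊕-hasOrderʳ : ∀ {p q n} → NonNegFrom d p n → HasOrder d q n → HasOrder d (p ⊕ q) n
  ⊕-hasOrderʳ p≥ q≐ .nonNegFrom = ⊕-nonNegFrom p≥ (nonNegFrom q≐)
  ⊕-hasOrderʳ p≥ q≐ .i₀ = i₀ q≐
  ⊕-hasOrderʳ p≥ q≐ .j₀ = j₀ q≐
  ⊕-hasOrderʳ p≥ q≐ .l₀ = l₀ q≐
  ⊕-hasOrderʳ p≥ q≐ .attained = attained q≐
  ⊕-hasOrderʳ p≥ q≐ .positive = ℤ.+-mono-≤-< (nonneg p≥ _ _ _) (positive q≐)

  -- Nonnegativity excludes cancellation: the coefficient at the sum of the two witnessing exponents
  -- is at least the product of the two positive coefficients, whichever witnesses are taken.
  ⊗-hasOrder : ∀ {p q m n} → HasOrder d p m → HasOrder d q n → HasOrder d (p ⊗ q) (m ℕ.+ n)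
  ⊗-hasOrder p≐ q≐ .nonNegFrom = ⊗-nonNegFrom (nonNegFrom p≐) (nonNegFrom q≐)
  ⊗-hasOrder p≐ q≐ .i₀ = i₀ p≐ ℕ.+ i₀ q≐
  ⊗-hasOrder p≐ q≐ .j₀ = j₀ p≐ ℕ.+ j₀ q≐
  ⊗-hasOrder p≐ q≐ .l₀ = l₀ p≐ ℕ.+ l₀ q≐
  ⊗-hasOrder p≐ q≐ .attained =
    ≡.trans (exponent-+ d (i₀ p≐) (j₀ p≐) (l₀ p≐) (i₀ q≐) (j₀ q≐) (l₀ q≐)) (≡.cong₂ ℕ._+_ (attained p≐) (attained q≐))
  ⊗-hasOrder {p} {q} p≐ q≐ .positive = ℤ.<-≤-trans leading-term
    (ℤ.≤-trans (term≤sumUpTo {l} (λ c → nn a b c) (ℕ.m≤m+n c _))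
    (ℤ.≤-trans (term≤sumUpTo {j} (λ b → sumUpTo-nonneg l λ c → nn a b c) (ℕ.m≤m+n b _))
               (term≤sumUpTo {i} (λ a → sumUpTo-nonneg j λ b → sumUpTo-nonneg l λ c → nn a b c) (ℕ.m≤m+n a _))))
    where
    a = i₀ p≐ ; b = j₀ p≐ ; c = l₀ p≐
    i = a ℕ.+ i₀ q≐ ; j = b ℕ.+ j₀ q≐ ; l = c ℕ.+ l₀ q≐
    nn : ∀ a b c → + 0 ℤ.≤ coeff p a b c ℤ.* coeff q (i ℕ.∸ a) (j ℕ.∸ b) (l ℕ.∸ c)
    nn a b c = *-nonneg (nonneg (nonNegFrom p≐) a b c) (nonneg (nonNegFrom q≐) (i ℕ.∸ a) (j ℕ.∸ b) (l ℕ.∸ c))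
    leading-term : + 0 ℤ.< coeff p a b c ℤ.* coeff q (i ℕ.∸ a) (j ℕ.∸ b) (l ℕ.∸ c)
    leading-term rewrite ℕ.m+n∸m≡n a (i₀ q≐) | ℕ.m+n∸m≡n b (j₀ q≐) | ℕ.m+n∸m≡n c (l₀ q≐) =
      *-pos (positive p≐) (positive q≐)

  order-≤ : ∀ {p q m n} → HasOrder d p m → HasOrder d q n → p ≃P q → n ℕ.≤ m
  order-≤ {m = m} {n} p≐ q≐ p≃q with n ℕ.≤? m
  ... | yes n≤m = n≤m
  ... | no  n≰m = contradiction
    (≡.trans (≃P⇒≈P p≃q _ _ _) (below (nonNegFrom q≐) (i₀ p≐) (j₀ p≐) (l₀ p≐)
      (≡.subst (ℕ._< n) (≡.sym (attained p≐)) (ℕ.≰⇒> n≰m))))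
    (λ p₀≡0 → ℤ.<-irrefl (≡.sym p₀≡0) (positive p≐))

  order-unique : ∀ {p q m n} → HasOrder d p m → HasOrder d q n → p ≃P q → m ≡ n
  order-unique p≐ q≐ p≃q = ℕ.≤-antisym (order-≤ q≐ p≐ (Poly.sym p≃q)) (order-≤ p≐ q≐ p≃q)

  hasOrder⇒nonzero : ∀ {p n} → HasOrder d p n → ¬ p ≃P con (+ 0)
  hasOrder⇒nonzero p≐ p≃0 = ℤ.<-irrefl (≡.sym (≃P⇒≈P p≃0 _ _ _)) (positive p≐)

δ : Fin 3 → Fin 3 → ℕ
δ d i = if does (d Fin.≟ i) then 1 else 0

var-nonneg : ∀ v i j l → + 0 ℤ.≤ coeff (var v) i j l
var-nonneg v i j l = go v
  where
  ind1-nonneg : ∀ i → + 0 ℤ.≤ ind1 i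
  ind1-nonneg zero          = +≤+ z≤n
  ind1-nonneg (suc zero)    = +≤+ z≤n
  ind1-nonneg (suc (suc i)) = +≤+ z≤n
  go : ∀ v → + 0 ℤ.≤ coeff (var v) i j l
  go zero             = *-nonneg (*-nonneg (ind1-nonneg i) (ind0-nonneg j)) (ind0-nonneg l)
  go (suc zero)       = *-nonneg (*-nonneg (ind0-nonneg i) (ind1-nonneg j)) (ind0-nonneg l)
  go (suc (suc zero)) = *-nonneg (*-nonneg (ind0-nonneg i) (ind0-nonneg j)) (ind1-nonneg l)

var-below : ∀ d v i j l → exponent d i j l ℕ.< δ d v → coeff (var v) i j l ≡ + 0
var-below zero             zero             zero    j l _ = ≡.refl
var-below (suc zero)       (suc zero)       zero    zero l _ = ≡.refl
var-below (suc zero)       (suc zero)       (suc i) zero l _ = ≡.refl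
var-below (suc (suc zero)) (suc (suc zero)) i j zero _ = ℤ.*-zeroʳ (ind0 i ℤ.* ind0 j)
var-below zero             zero             (suc i) j l (s≤s ())
var-below (suc zero)       (suc zero)       i (suc j) l (s≤s ())
var-below (suc (suc zero)) (suc (suc zero)) i j (suc l) (s≤s ())

var-hasOrder : ∀ d v → HasOrder d (var v) (δ d v)
var-hasOrder d v = record
  { nonNegFrom = record { nonneg = var-nonneg v ; below = var-below d v }
  ; i₀ = δ zero v ; j₀ = δ (suc zero) v ; l₀ = δ (suc (suc zero)) v
  ; attained = attained′ d
  ; positive = positive′ v
  }
  where
  attained′ : ∀ d → exponent d (δ zero v) (δ (suc zero) v) (δ (suc (suc zero)) v) ≡ δ d v
  attained′ zero             = ≡.refl
  attained′ (suc zero)       = ≡.refl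
  attained′ (suc (suc zero)) = ≡.refl
  positive′ : ∀ v → + 0 ℤ.< coeff (var v) (δ zero v) (δ (suc zero) v) (δ (suc (suc zero)) v)
  positive′ zero             = +<+ (s≤s z≤n)
  positive′ (suc zero)       = +<+ (s≤s z≤n)
  positive′ (suc (suc zero)) = +<+ (s≤s z≤n)

-- Parity of orders under exchange

open MarkovIdentities fracRing

-- The term k u v never has the smallest order, its order being the mean of those of u² and v².
exchange-hasEvenOrder : ∀ {d u v m n} k → HasOrder d u m → HasOrder d v n →
  ∃[ t ] HasOrder d (((u ⊗ u) ⊕ ((con (+ k) ⊗ u) ⊗ v)) ⊕ (v ⊗ v)) (t ℕ.+ t)
exchange-hasEvenOrder {m = m} {n} k u≐ v≐ with ℕ.≤-total m n
... | inj₁ m≤n = m , ⊕-hasOrderˡ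
  (⊕-hasOrderˡ (⊗-hasOrder u≐ u≐)
    (nonNegFrom-weaken (ℕ.+-monoʳ-≤ m m≤n)
      (⊗-nonNegFrom (⊗-nonNegFrom (con-nonNegFrom k) (nonNegFrom u≐)) (nonNegFrom v≐))))
  (nonNegFrom-weaken (ℕ.+-mono-≤ m≤n m≤n) (nonNegFrom (⊗-hasOrder v≐ v≐)))
... | inj₂ n≤m = n , ⊕-hasOrderʳ
  (⊕-nonNegFrom (nonNegFrom-weaken (ℕ.+-mono-≤ n≤m n≤m) (nonNegFrom (⊗-hasOrder u≐ u≐)))
    (nonNegFrom-weaken (ℕ.+-monoˡ-≤ n n≤m)
      (⊗-nonNegFrom (⊗-nonNegFrom (con-nonNegFrom k) (nonNegFrom u≐)) (nonNegFrom v≐))))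
  (⊗-hasOrder v≐ v≐)

-- y = N / D with nonnegative coefficients, and ord N − ord D ≡ e mod 2.
record OrderParity (d : Fin 3) (e : ℕ) (y : Frac) : Set where
  field
    {N D}    : Expr
    {n m t}  : ℕ
    N-order  : HasOrder d N n
    D-order  : HasOrder d D m
    fraction : y *F ↑ D ≃F ↑ N
    parity   : n ℕ.+ m ≡ e ℕ.+ 2 ℕ.* t

module _ {d : Fin 3} where

  -- Numerator and denominator of `a` trade places up to two factors of even order: the exchange
  -- polynomial, and the square of the common denominator of `b` and `c`. The sum of the two orders,
  -- which has the parity of their difference, therefore changes by an even number.
  orderParity-mutate : ∀ k {e e₁ e₂ a b c a′} →
    OrderParity d e a → OrderParity d e₁ b → OrderParity d e₂ c →
    a′ *F a ≃F exchange-poly (natF k) b c → OrderParity d e a′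
  orderParity-mutate k {e} {a = a} {b} {c} {a′} A B C exch with exchange-hasEvenOrder k
      (⊗-hasOrder (OrderParity.N-order B) (OrderParity.D-order C))
      (⊗-hasOrder (OrderParity.N-order C) (OrderParity.D-order B))
  ... | t , E-order = record
    { t        = A.t ℕ.+ (t ℕ.+ B.m ℕ.+ C.m)
    ; N-order  = ⊗-hasOrder E-order A.D-order
    ; D-order  = ⊗-hasOrder (⊗-hasOrder (⊗-hasOrder B.D-order C.D-order) (⊗-hasOrder B.D-order C.D-order)) A.N-order
    ; fraction = F.trans
        (exchange-fraction (natF k) a b c a′ (↑ A.N) (↑ A.D) (↑ B.N) (↑ B.D) (↑ C.N) (↑ C.D)
          A.fraction B.fraction C.fraction exch)
        (F.*-congʳ (F.sym (F.trans (↑-⊕ _ _) (F.+-congʳ (↑-⊕ _ _)))))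
    ; parity   = begin
        (t ℕ.+ t ℕ.+ A.m) ℕ.+ ((B.m ℕ.+ C.m) ℕ.+ (B.m ℕ.+ C.m) ℕ.+ A.n)
          ≡⟨ solve 5 (λ t m n b c → (t :+ t :+ m) :+ ((b :+ c) :+ (b :+ c) :+ n) := (n :+ m) :+ con 2 :* (t :+ b :+ c))
               ≡.refl t A.m A.n B.m C.m ⟩
        (A.n ℕ.+ A.m) ℕ.+ 2 ℕ.* (t ℕ.+ B.m ℕ.+ C.m)
          ≡⟨ ≡.cong (ℕ._+ 2 ℕ.* (t ℕ.+ B.m ℕ.+ C.m)) A.parity ⟩
        (e ℕ.+ 2 ℕ.* A.t) ℕ.+ 2 ℕ.* (t ℕ.+ B.m ℕ.+ C.m)
          ≡⟨ solve 3 (λ e s r → (e :+ con 2 :* s) :+ con 2 :* r := e :+ con 2 :* (s :+ r))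
               ≡.refl e A.t (t ℕ.+ B.m ℕ.+ C.m) ⟩
        e ℕ.+ 2 ℕ.* (A.t ℕ.+ (t ℕ.+ B.m ℕ.+ C.m)) ∎
    }
    where
    module A = OrderParity A
    module B = OrderParity B
    module C = OrderParity C
    open ≡.≡-Reasoning
    open +-*-Solver

  cross-products : ∀ y N D N′ D′ → y *F D ≃F N → y *F D′ ≃F N′ → N *F D′ ≃F N′ *F D
  cross-products y N D N′ D′ yD≃N yD′≃N′ = begin
    N *F D′         ≈⟨ F.*-congʳ yD≃N ⟨
    y *F D *F D′    ≈⟨ F.*-assoc y D D′ ⟩
    y *F (D *F D′)  ≈⟨ F.*-congˡ {y} (F.*-comm D D′) ⟩
    y *F (D′ *F D)  ≈⟨ F.*-assoc y D′ D ⟨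
    y *F D′ *F D    ≈⟨ F.*-congʳ yD′≃N′ ⟩
    N′ *F D         ∎
    where open SetoidReasoning F.setoid

  -- Two fractions for `y` have equal cross products, so `A.n + B.m` and `B.n + A.m` agree and their
  -- sum is even; the two parity equations make the same sum odd.
  orderParity-disjoint : ∀ {y} → OrderParity d 1 y → ¬ OrderParity d 0 y
  orderParity-disjoint {y} A B = ℕ.even≢odd (B.n ℕ.+ A.m) (A.t ℕ.+ B.t) (begin
    2 ℕ.* (B.n ℕ.+ A.m)
      ≡⟨ ≡.cong ((B.n ℕ.+ A.m) ℕ.+_) (ℕ.+-identityʳ _) ⟩
    (B.n ℕ.+ A.m) ℕ.+ (B.n ℕ.+ A.m)
      ≡⟨ ≡.cong (ℕ._+ (B.n ℕ.+ A.m)) orders-agree ⟨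
    (A.n ℕ.+ B.m) ℕ.+ (B.n ℕ.+ A.m)
      ≡⟨ solve 4 (λ n m n′ m′ → (n :+ m′) :+ (n′ :+ m) := (n :+ m) :+ (n′ :+ m′)) ≡.refl A.n A.m B.n B.m ⟩
    (A.n ℕ.+ A.m) ℕ.+ (B.n ℕ.+ B.m)
      ≡⟨ ≡.cong₂ ℕ._+_ A.parity B.parity ⟩
    (1 ℕ.+ 2 ℕ.* A.t) ℕ.+ 2 ℕ.* B.t
      ≡⟨ ≡.cong suc (ℕ.*-distribˡ-+ 2 A.t B.t) ⟨
    suc (2 ℕ.* (A.t ℕ.+ B.t)) ∎)
    where
    module A = OrderParity A
    module B = OrderParity B
    open ≡.≡-Reasoning
    open +-*-Solver
    orders-agree : A.n ℕ.+ B.m ≡ B.n ℕ.+ A.m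
    orders-agree = order-unique (⊗-hasOrder A.N-order B.D-order) (⊗-hasOrder B.N-order A.D-order)
                     (↑-injective (cross-products y (↑ A.N) (↑ A.D) (↑ B.N) (↑ B.D) A.fraction B.fraction))

  orderParity⇒nonzero : ∀ {e y} → OrderParity d e y → ¬ y ≃F 0F
  orderParity⇒nonzero {y = y} A y≃0 = hasOrder⇒nonzero A.N-order (↑-injective (begin
    ↑ A.N        ≈⟨ A.fraction ⟨
    y *F ↑ A.D   ≈⟨ F.*-congʳ y≃0 ⟩
    0F *F ↑ A.D  ≈⟨ F.zeroˡ _ ⟩
    0F           ∎))
    where
    module A = OrderParity A
    open SetoidReasoning F.setoid

  orderParity-resp : ∀ {e y z} → y ≃F z → OrderParity d e y → OrderParity d e z
  orderParity-resp y≃z A = record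
    { t = t ; N-order = N-order ; D-order = D-order ; fraction = F.trans (F.*-congʳ (F.sym y≃z)) fraction ; parity = parity }
    where open OrderParity A

-- Clusters

LC-orderParity : ∀ d {k₁ k₂ k₃ a b c} → LC k₁ k₂ k₃ a b c → ∀ i → OrderParity d (δ d i) (sel i a b c)
LC-orderParity d init i = orderParity-resp (F.reflexive (X≡sel i)) (record
  { t        = 0
  ; N-order  = var-hasOrder d i
  ; D-order  = record { nonNegFrom = con-nonNegFrom 1 ; attained = exponent-0 d ; positive = +<+ (s≤s z≤n) }
  ; fraction = F.*-identityʳ (X i)
  ; parity   = ≡.refl
  })
  where
  exponent-0 : ∀ d → exponent d 0 0 0 ≡ 0
  exponent-0 0₃ = ≡.refl
  exponent-0 1₃ = ≡.refl
  exponent-0 2₃ = ≡.refl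
  X≡sel : ∀ i → X i ≡ sel i (X 0₃) (X 1₃) (X 2₃)
  X≡sel 0₃ = ≡.refl
  X≡sel 1₃ = ≡.refl
  X≡sel 2₃ = ≡.refl
LC-orderParity d {k₁} (mut₁ lc exch) 0₃ = orderParity-mutate k₁
  (LC-orderParity d lc 0₃) (LC-orderParity d lc 1₃) (LC-orderParity d lc 2₃) (≈F⇒≃F exch)
LC-orderParity d (mut₁ lc exch) 1₃ = LC-orderParity d lc 1₃
LC-orderParity d (mut₁ lc exch) 2₃ = LC-orderParity d lc 2₃
LC-orderParity d {k₂ = k₂} (mut₂ lc exch) 1₃ = orderParity-mutate k₂
  (LC-orderParity d lc 1₃) (LC-orderParity d lc 0₃) (LC-orderParity d lc 2₃) (≈F⇒≃F exch)
LC-orderParity d (mut₂ lc exch) 0₃ = LC-orderParity d lc 0₃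
LC-orderParity d (mut₂ lc exch) 2₃ = LC-orderParity d lc 2₃
LC-orderParity d {k₃ = k₃} (mut₃ lc exch) 2₃ = orderParity-mutate k₃
  (LC-orderParity d lc 2₃) (LC-orderParity d lc 0₃) (LC-orderParity d lc 1₃) (≈F⇒≃F exch)
LC-orderParity d (mut₃ lc exch) 0₃ = LC-orderParity d lc 0₃
LC-orderParity d (mut₃ lc exch) 1₃ = LC-orderParity d lc 1₃

δ-diagonal : ∀ i → δ i i ≡ 1
δ-diagonal i with i Fin.≟ i
... | yes _   = ≡.refl
... | no  i≢i = contradiction ≡.refl i≢i

δ-off : ∀ {i j} → i ≢ j → δ i j ≡ 0
δ-off {i} {j} i≢j with i Fin.≟ j
... | yes i≡j = contradiction i≡j i≢j
... | no  _   = ≡.refl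

clusterVar-orderParity : ∀ d {k₁ k₂ k₃} i y → ClusterVarAt k₁ k₂ k₃ i y → OrderParity d (δ d i) y
clusterVar-orderParity d i y (_ , _ , _ , lc , y≈) = orderParity-resp (≈F⇒≃F y≈) (LC-orderParity d lc i)

-- The order is taken in the variable with index `i` itself: it is odd for position `i` and even for
-- every other position.
position-unique : ∀ {k₁ k₂ k₃} i j y → ClusterVarAt k₁ k₂ k₃ i y → ClusterVarAt k₁ k₂ k₃ j y → i ≡ j
position-unique i j y yᵢ yⱼ with i Fin.≟ j
... | yes i≡j = i≡j
... | no  i≢j = contradiction
  (≡.subst (λ e → OrderParity i e y) (δ-off i≢j) (clusterVar-orderParity i j y yⱼ))
  (orderParity-disjoint (≡.subst (λ e → OrderParity i e y) (δ-diagonal i) (clusterVar-orderParity i i y yᵢ)))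

LC-nonzero : ∀ {k₁ k₂ k₃ a b c} → LC k₁ k₂ k₃ a b c → ∀ i → ¬ sel i a b c ≃F 0F
-- Any of the three variables serves: a numerator having an order in it has a positive coefficient.
LC-nonzero lc i = orderParity⇒nonzero (LC-orderParity zero lc i)

-- The Markov equation on labeled clusters

module _ (k₁ k₂ k₃ : ℕ) where

  private
    M = 𝓜 k₁ k₂ k₃
    κ₁ = natF k₁
    κ₂ = natF k₂
    κ₃ = natF k₃

  markov-init : markov M κ₁ κ₂ κ₃ (X 0₃) (X 1₃) (X 2₃) ≃F 0F
  markov-init = x≈y⇒x∙y⁻¹≈ε (begin
    x₁ *F x₁ +F x₂ *F x₂ +F x₃ *F x₃ +F κ₁ *F x₂ *F x₃ +F κ₂ *F x₁ *F x₃ +F κ₃ *F x₁ *F x₂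
      ≈⟨ F.+-cong (F.+-cong (F.+-cong squares (F.*-assoc κ₁ x₂ x₃)) (F.*-assoc κ₂ x₁ x₃)) (F.*-assoc κ₃ x₁ x₂) ⟩
    ↑ ((sq x₁ ⊕ sq x₂) ⊕ sq x₃) +F κ₁ *F (x₂ *F x₃) +F κ₂ *F (x₁ *F x₃) +F κ₃ *F (x₁ *F x₂)
      ≈⟨ F.+-congʳ (F.+-congʳ (↑-⊕ _ _)) ⟨
    ↑ (((sq x₁ ⊕ sq x₂) ⊕ sq x₃) ⊕ (con (+ k₁) ⊗ (var 1₃ ⊗ var 2₃))) +F κ₂ *F (x₁ *F x₃) +F κ₃ *F (x₁ *F x₂)
      ≈⟨ F.+-congʳ (↑-⊕ _ _) ⟨
    ↑ ((((sq x₁ ⊕ sq x₂) ⊕ sq x₃) ⊕ (con (+ k₁) ⊗ (var 1₃ ⊗ var 2₃))) ⊕ (con (+ k₂) ⊗ (var 0₃ ⊗ var 2₃)))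
      +F κ₃ *F (x₁ *F x₂)
      ≈⟨ ↑-⊕ _ _ ⟨
    ↑ (num M)
      ≈⟨ cross-multiplied (solve 5 (λ n x y z i → n :* (x :* (y :* (z :* i))) := n :* x :* y :* z :* i)
           Poly.refl (num M) (var 0₃) (var 1₃) (var 2₃) (con (+ 1))) ⟩
    M *F x₁ *F x₂ *F x₃ ∎)
    where
    open SetoidReasoning F.setoid
    open import Algebra.Properties.Group F.+-group using (x≈y⇒x∙y⁻¹≈ε)
    open PolySolver
    x₁ = X 0₃
    x₂ = X 1₃
    x₃ = X 2₃
    sq : Frac → Expr
    sq f = num f ⊗ num f
    squares : x₁ *F x₁ +F x₂ *F x₂ +F x₃ *F x₃ ≃F ↑ ((sq x₁ ⊕ sq x₂) ⊕ sq x₃)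
    squares = F.trans (F.+-congʳ (F.sym (↑-⊕ _ _))) (F.sym (↑-⊕ _ _))

  -- `markov-mutate` exchanges the first entry, so the variable being exchanged is moved to the
  -- front, the other two keeping the order in which the mutation writes its exchange polynomial.
  LC-markov : ∀ {a b c} → LC k₁ k₂ k₃ a b c → markov M κ₁ κ₂ κ₃ a b c ≃F 0F
  LC-markov init = markov-init
  LC-markov (mut₁ {a} {b} {c} {a′} lc exch) =
    markov-mutate M κ₁ κ₂ κ₃ a b c a′ (≈F⇒≃F exch) markov≃0
      (*F-cancel-0 a _ (a*vieta≈0 M κ₁ κ₂ κ₃ a b c a′ (≈F⇒≃F exch) markov≃0) (LC-nonzero lc 0₃))
    where markov≃0 = LC-markov lc
  LC-markov (mut₂ {a} {b} {c} {b′} lc exch) =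
    F.trans (markov-swap₁₂ M κ₁ κ₂ κ₃ a b′ c)
      (markov-mutate M κ₂ κ₁ κ₃ b a c b′ (≈F⇒≃F exch) markov≃0
        (*F-cancel-0 b _ (a*vieta≈0 M κ₂ κ₁ κ₃ b a c b′ (≈F⇒≃F exch) markov≃0) (LC-nonzero lc 1₃)))
    where markov≃0 = F.trans (markov-swap₁₂ M κ₂ κ₁ κ₃ b a c) (LC-markov lc)
  LC-markov (mut₃ {a} {b} {c} {c′} lc exch) =
    F.trans (rotate M κ₁ κ₂ κ₃ a b c′)
      (markov-mutate M κ₃ κ₁ κ₂ c a b c′ (≈F⇒≃F exch) markov≃0
        (*F-cancel-0 c _ (a*vieta≈0 M κ₃ κ₁ κ₂ c a b c′ (≈F⇒≃F exch) markov≃0) (LC-nonzero lc 2₃)))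
    where
    rotate : ∀ M k₁ k₂ k₃ a b c → markov M k₁ k₂ k₃ a b c ≃F markov M k₃ k₁ k₂ c a b
    rotate M k₁ k₂ k₃ a b c = F.trans (markov-swap₂₃ M k₁ k₂ k₃ a b c) (markov-swap₁₂ M k₁ k₃ k₂ a c b)
    markov≃0 = F.trans (F.sym (rotate M κ₁ κ₂ κ₃ a b c)) (LC-markov lc)

-- Non-labeled clusters

-- A permutation is a function with an inverse, and `sel` does not compute on its unknown values.
-- Matching on the six possible triples of values makes the entries and their parities reduce.
data Arrangement : Fin 3 → Fin 3 → Fin 3 → Set where
  ⟨012⟩ : Arrangement 0₃ 1₃ 2₃
  ⟨021⟩ : Arrangement 0₃ 2₃ 1₃
  ⟨102⟩ : Arrangement 1₃ 0₃ 2₃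
  ⟨120⟩ : Arrangement 1₃ 2₃ 0₃
  ⟨201⟩ : Arrangement 2₃ 0₃ 1₃
  ⟨210⟩ : Arrangement 2₃ 1₃ 0₃

arrange : ∀ {i j l} → i ≢ j → i ≢ l → j ≢ l → Arrangement i j l
arrange {0₃} {1₃} {2₃} _ _ _ = ⟨012⟩
arrange {0₃} {2₃} {1₃} _ _ _ = ⟨021⟩
arrange {1₃} {0₃} {2₃} _ _ _ = ⟨102⟩
arrange {1₃} {2₃} {0₃} _ _ _ = ⟨120⟩
arrange {2₃} {0₃} {1₃} _ _ _ = ⟨201⟩
arrange {2₃} {1₃} {0₃} _ _ _ = ⟨210⟩
arrange {0₃} {0₃} i≢j _ _ = contradiction ≡.refl i≢j
arrange {1₃} {1₃} i≢j _ _ = contradiction ≡.refl i≢j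
arrange {2₃} {2₃} i≢j _ _ = contradiction ≡.refl i≢j
arrange {0₃} {_} {0₃} _ i≢l _ = contradiction ≡.refl i≢l
arrange {1₃} {_} {1₃} _ i≢l _ = contradiction ≡.refl i≢l
arrange {2₃} {_} {2₃} _ i≢l _ = contradiction ≡.refl i≢l
arrange {_} {0₃} {0₃} _ _ j≢l = contradiction ≡.refl j≢l
arrange {_} {1₃} {1₃} _ _ j≢l = contradiction ≡.refl j≢l
arrange {_} {2₃} {2₃} _ _ j≢l = contradiction ≡.refl j≢l

arrangement : (π : Permutation′ 3) → Arrangement (π ⟨$⟩ʳ 0₃) (π ⟨$⟩ʳ 1₃) (π ⟨$⟩ʳ 2₃)
arrangement π = arrange (distinct λ ()) (distinct λ ()) (distinct λ ())
  where
  distinct : ∀ {i j} → i ≢ j → π ⟨$⟩ʳ i ≢ π ⟨$⟩ʳ j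
  distinct i≢j πi≡πj = i≢j (≡.trans (≡.sym (inverseˡ π)) (≡.trans (≡.cong (π ⟨$⟩ˡ_) πi≡πj) (inverseˡ π)))

module _ (k₁ k₂ k₃ : ℕ) where

  private
    M = 𝓜 k₁ k₂ k₃
    κ : Fin 3 → Frac
    κ i = natF (kOf k₁ k₂ k₃ i)

  arranged-markov : ∀ {i j l a b c} → Arrangement i j l → LC k₁ k₂ k₃ a b c →
    markov M (κ i) (κ j) (κ l) (sel i a b c) (sel j a b c) (sel l a b c) ≃F 0F
  arranged-markov {a = a} {b} {c} σ lc = F.trans (F.sym (rearrange σ)) (LC-markov k₁ k₂ k₃ lc)
    where
    rearrange : ∀ {i j l} → Arrangement i j l → markov M (κ 0₃) (κ 1₃) (κ 2₃) a b c ≃F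
                markov M (κ i) (κ j) (κ l) (sel i a b c) (sel j a b c) (sel l a b c)
    rearrange ⟨012⟩ = F.refl
    rearrange ⟨021⟩ = markov-swap₂₃ M (κ 0₃) (κ 1₃) (κ 2₃) a b c
    rearrange ⟨102⟩ = markov-swap₁₂ M (κ 0₃) (κ 1₃) (κ 2₃) a b c
    rearrange ⟨120⟩ = F.trans (rearrange ⟨102⟩) (markov-swap₂₃ M (κ 1₃) (κ 0₃) (κ 2₃) b a c)
    rearrange ⟨201⟩ = F.trans (rearrange ⟨021⟩) (markov-swap₁₂ M (κ 0₃) (κ 2₃) (κ 1₃) a c b)
    rearrange ⟨210⟩ = F.trans (rearrange ⟨021⟩) (F.trans (markov-swap₁₂ M (κ 0₃) (κ 2₃) (κ 1₃) a c b)
                                                         (markov-swap₂₃ M (κ 2₃) (κ 0₃) (κ 1₃) c a b))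

  record ExchangedCluster (i j l : Fin 3) (a b c y : Frac) : Set where
    field
      {a′ b′ c′} : Frac
      cluster    : LC k₁ k₂ k₃ a′ b′ c′
      kept₁      : sel i a′ b′ c′ ≡ sel i a b c
      kept₂      : sel j a′ b′ c′ ≡ sel j a b c
      exchanged  : sel l a′ b′ c′ ≡ y

  arranged-mutation : ∀ {i j l a b c} y → Arrangement i j l → LC k₁ k₂ k₃ a b c →
    y *F sel l a b c ≃F exchange-poly (κ l) (sel i a b c) (sel j a b c) → ExchangedCluster i j l a b c y
  arranged-mutation y ⟨012⟩ lc exch = record
    { cluster = mut₃ lc (≃F⇒≈F exch) ; kept₁ = ≡.refl ; kept₂ = ≡.refl ; exchanged = ≡.refl }
  arranged-mutation y ⟨021⟩ lc exch = record
    { cluster = mut₂ lc (≃F⇒≈F exch) ; kept₁ = ≡.refl ; kept₂ = ≡.refl ; exchanged = ≡.refl }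
  arranged-mutation {a = a} {b} {c} y ⟨102⟩ lc exch = record
    { cluster = mut₃ lc (≃F⇒≈F (F.trans exch (exchange-poly-comm (κ 2₃) b a)))
    ; kept₁ = ≡.refl ; kept₂ = ≡.refl ; exchanged = ≡.refl }
  arranged-mutation y ⟨120⟩ lc exch = record
    { cluster = mut₁ lc (≃F⇒≈F exch) ; kept₁ = ≡.refl ; kept₂ = ≡.refl ; exchanged = ≡.refl }
  arranged-mutation {a = a} {b} {c} y ⟨201⟩ lc exch = record
    { cluster = mut₂ lc (≃F⇒≈F (F.trans exch (exchange-poly-comm (κ 1₃) c a)))
    ; kept₁ = ≡.refl ; kept₂ = ≡.refl ; exchanged = ≡.refl }
  arranged-mutation {a = a} {b} {c} y ⟨210⟩ lc exch = record
    { cluster = mut₁ lc (≃F⇒≈F (F.trans exch (exchange-poly-comm (κ 0₃) c b)))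
    ; kept₁ = ≡.refl ; kept₂ = ≡.refl ; exchanged = ≡.refl }

-- Clearing denominators

module DenominatorIdentities {r ℓ} (R : CommutativeRing r ℓ) where
  open CommutativeRing R
  open SetoidReasoning setoid
  open IntegerCoefficientSolver R

  clear-+ : ∀ f g m n p q → f * m ≈ p → g * n ≈ q → (f + g) * (m * n) ≈ p * n + q * m
  clear-+ f g m n p q fm≈p gn≈q = begin
    (f + g) * (m * n)
      ≈⟨ solve 4 (λ f g m n → (f :+ g) :* (m :* n) := f :* m :* n :+ g :* n :* m) refl f g m n ⟩
    f * m * n + g * n * m ≈⟨ +-cong (*-congʳ fm≈p) (*-congʳ gn≈q) ⟩
    p * n + q * m         ∎

  clear-* : ∀ f g m n p q → f * m ≈ p → g * n ≈ q → (f * g) * (m * n) ≈ p * q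
  clear-* f g m n p q fm≈p gn≈q = begin
    (f * g) * (m * n)
      ≈⟨ solve 4 (λ f g m n → (f :* g) :* (m :* n) := (f :* m) :* (g :* n)) refl f g m n ⟩
    (f * m) * (g * n) ≈⟨ *-cong fm≈p gn≈q ⟩
    p * q             ∎

  clear-neg : ∀ f m p → f * m ≈ p → (- f) * m ≈ - p
  clear-neg f m p fm≈p = begin
    (- f) * m ≈⟨ solve 2 (λ f m → (:- f) :* m := :- (f :* m)) refl f m ⟩
    - (f * m) ≈⟨ -‿cong fm≈p ⟩
    - p       ∎

  x-[x-k]≈k : ∀ x k → x - (x - k) ≈ k
  x-[x-k]≈k = solve 2 (λ x k → x :- (x :- k) := k) refl

  reverse-dot : ∀ x y z w → x * y + z * w ≈ w * z + y * x
  reverse-dot = solve 4 (λ x y z w → x :* y :+ z :* w := w :* z :+ y :* x) refl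

open DenominatorIdentities fracRing

-- Laurent polynomials and CGC matrices

monomial : ℕ → ℕ → ℕ → Expr
monomial e₁ e₂ e₃ = pow (var 0₃) e₁ ⊗ (pow (var 1₃) e₂ ⊗ pow (var 2₃) e₃)

pow-+ : ∀ x m n → pow x (m ℕ.+ n) ≃P pow x m ⊗ pow x n
pow-+ x zero    n = Poly.sym (Poly.*-identityˡ _)
pow-+ x (suc m) n = Poly.trans (Poly.*-congˡ (pow-+ x m n)) (Poly.sym (Poly.*-assoc _ _ _))

monomial-+ : ∀ e₁ e₂ e₃ f₁ f₂ f₃ →
             monomial (e₁ ℕ.+ f₁) (e₂ ℕ.+ f₂) (e₃ ℕ.+ f₃) ≃P monomial e₁ e₂ e₃ ⊗ monomial f₁ f₂ f₃
monomial-+ e₁ e₂ e₃ f₁ f₂ f₃ = Poly.trans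
  (Poly.*-cong (pow-+ _ e₁ f₁) (Poly.*-cong (pow-+ _ e₂ f₂) (pow-+ _ e₃ f₃)))
  (PolySolver.solve 6 (λ a b c a′ b′ c′ →
      (a :* a′) :* ((b :* b′) :* (c :* c′)) := (a :* (b :* c)) :* (a′ :* (b′ :* c′)))
    Poly.refl (pow (var 0₃) e₁) (pow (var 1₃) e₂) (pow (var 2₃) e₃)
    (pow (var 0₃) f₁) (pow (var 1₃) f₂) (pow (var 2₃) f₃))
  where open PolySolver using (_:*_; _:=_)

laurent-+ : ∀ {f g} → Laurent f → Laurent g → Laurent (f +F g)
laurent-+ {f} {g} (p , e₁ , e₂ , e₃ , fm≈p) (q , f₁ , f₂ , f₃ , gn≈q) =
  (p ⊗ n) ⊕ (q ⊗ m) , e₁ ℕ.+ f₁ , e₂ ℕ.+ f₂ , e₃ ℕ.+ f₃ , ≃F⇒≈F (begin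
    (f +F g) *F ↑ (monomial (e₁ ℕ.+ f₁) (e₂ ℕ.+ f₂) (e₃ ℕ.+ f₃))
      ≈⟨ F.*-congˡ {f +F g} (↑-cong (monomial-+ e₁ e₂ e₃ f₁ f₂ f₃)) ⟩
    (f +F g) *F (↑ m *F ↑ n)
      ≈⟨ clear-+ f g (↑ m) (↑ n) (↑ p) (↑ q) (≈F⇒≃F fm≈p) (≈F⇒≃F gn≈q) ⟩
    ↑ p *F ↑ n +F ↑ q *F ↑ m
      ≈⟨ ↑-⊕ (p ⊗ n) (q ⊗ m) ⟨
    ↑ ((p ⊗ n) ⊕ (q ⊗ m)) ∎)
  where
  open SetoidReasoning F.setoid
  m = monomial e₁ e₂ e₃
  n = monomial f₁ f₂ f₃

laurent-* : ∀ {f g} → Laurent f → Laurent g → Laurent (f *F g)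
laurent-* {f} {g} (p , e₁ , e₂ , e₃ , fm≈p) (q , f₁ , f₂ , f₃ , gn≈q) =
  p ⊗ q , e₁ ℕ.+ f₁ , e₂ ℕ.+ f₂ , e₃ ℕ.+ f₃ , ≃F⇒≈F (begin
    (f *F g) *F ↑ (monomial (e₁ ℕ.+ f₁) (e₂ ℕ.+ f₂) (e₃ ℕ.+ f₃))
      ≈⟨ F.*-congˡ {f *F g} (↑-cong (monomial-+ e₁ e₂ e₃ f₁ f₂ f₃)) ⟩
    (f *F g) *F (↑ m *F ↑ n)
      ≈⟨ clear-* f g (↑ m) (↑ n) (↑ p) (↑ q) (≈F⇒≃F fm≈p) (≈F⇒≃F gn≈q) ⟩
    ↑ p *F ↑ q ∎)
  where
  open SetoidReasoning F.setoid
  m = monomial e₁ e₂ e₃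
  n = monomial f₁ f₂ f₃

laurent-neg : ∀ {f} → Laurent f → Laurent (-F f)
laurent-neg {f} (p , e₁ , e₂ , e₃ , fm≈p) =
  neg p , e₁ , e₂ , e₃ , ≃F⇒≈F (clear-neg f (↑ (monomial e₁ e₂ e₃)) (↑ p) (≈F⇒≃F fm≈p))

laurent-- : ∀ {f g} → Laurent f → Laurent g → Laurent (f -F g)
laurent-- {f} {g} lf lg = laurent-+ {f} { -F g} lf (laurent-neg {g} lg)

laurent-resp : ∀ {f g} → f ≃F g → Laurent f → Laurent g
laurent-resp {f} {g} f≃g (p , e₁ , e₂ , e₃ , fm≈p) =
  p , e₁ , e₂ , e₃ , ≃F⇒≈F {g *F ↑ m} {↑ p}
    (F.trans (F.*-congʳ (F.sym f≃g)) (≈F⇒≃F {f *F ↑ m} {↑ p} fm≈p))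
  where m = monomial e₁ e₂ e₃

laurent-natF : ∀ k → Laurent (natF k)
-- The numerator is left unsimplified, so that both sides have the same coefficients by computation.
laurent-natF k = con (+ k) ⊗ monomial 0 0 0 , 0 , 0 , 0 , λ _ _ _ → ≡.refl

laurent-𝓜 : ∀ k₁ k₂ k₃ → Laurent (𝓜 k₁ k₂ k₃)
laurent-𝓜 k₁ k₂ k₃ = num M , 1 , 1 , 1 , ≃F⇒≈F {M *F ↑ (monomial 1 1 1)} {↑ (num M)} (cross-multiplied (Poly.trans
  (Poly.*-identityʳ _)
  (Poly.*-congˡ (Poly.*-cong (Poly.*-identityʳ _) (Poly.*-congʳ (Poly.*-identityʳ _))))))
  where M = 𝓜 k₁ k₂ k₃

infix 4 _≃M_
record _≃M_ (A B : Mat) : Set where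
  field
    ≃11 : m11 A ≃F m11 B
    ≃12 : m12 A ≃F m12 B
    ≃21 : m21 A ≃F m21 B
    ≃22 : m22 A ≃F m22 B
open _≃M_

≈M⇒≃M : ∀ {A B} → A ≈M B → A ≃M B
≈M⇒≃M (e₁₁ , e₁₂ , e₂₁ , e₂₂) = record { ≃11 = ≈F⇒≃F e₁₁ ; ≃12 = ≈F⇒≃F e₁₂ ; ≃21 = ≈F⇒≃F e₂₁ ; ≃22 = ≈F⇒≃F e₂₂ }

≃M⇒≈M : ∀ {A B} → A ≃M B → A ≈M B
≃M⇒≈M e = ≃F⇒≈F (≃11 e) , ≃F⇒≈F (≃12 e) , ≃F⇒≈F (≃21 e) , ≃F⇒≈F (≃22 e)

≃M-sym : ∀ {A B} → A ≃M B → B ≃M A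
≃M-sym e = record { ≃11 = F.sym (≃11 e) ; ≃12 = F.sym (≃12 e) ; ≃21 = F.sym (≃21 e) ; ≃22 = F.sym (≃22 e) }

≃M-trans : ∀ {A B C} → A ≃M B → B ≃M C → A ≃M C
≃M-trans e f = record
  { ≃11 = F.trans (≃11 e) (≃11 f) ; ≃12 = F.trans (≃12 e) (≃12 f)
  ; ≃21 = F.trans (≃21 e) (≃21 f) ; ≃22 = F.trans (≃22 e) (≃22 f) }

-F-cong₂ : ∀ {f f′ g g′} → f ≃F f′ → g ≃F g′ → f -F g ≃F f′ -F g′
-F-cong₂ f≃ g≃ = F.+-cong f≃ (F.-‿cong g≃)

-- Transposition in the antidiagonal, J Aᵀ J for the matrix J that swaps the two coordinates. Unlike
-- transposition it keeps the (1,2)-entry, which carries the cluster variable.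
flip : Mat → Mat
flip A = mat (m22 A) (m12 A) (m21 A) (m11 A)

flip-cong : ∀ {A B} → A ≃M B → flip A ≃M flip B
flip-cong e = record { ≃11 = ≃22 e ; ≃12 = ≃12 e ; ≃21 = ≃21 e ; ≃22 = ≃11 e }

InSL2-resp : ∀ {A B} → A ≃M B → InSL2 A → InSL2 B
InSL2-resp {A} {B} e (l₁₁ , l₁₂ , l₂₁ , l₂₂ , det≈1) =
  laurent-resp (≃11 e) l₁₁ , laurent-resp (≃12 e) l₁₂ , laurent-resp (≃21 e) l₂₁ , laurent-resp (≃22 e) l₂₂ ,
  ≃F⇒≈F {det B} {1F} (F.trans (F.sym (-F-cong₂ (F.*-cong (≃11 e) (≃22 e)) (F.*-cong (≃12 e) (≃21 e))))
                              (≈F⇒≃F {det A} {1F} det≈1))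

InSL2-flip : ∀ {A} → InSL2 A → InSL2 (flip A)
InSL2-flip {A} (l₁₁ , l₁₂ , l₂₁ , l₂₂ , det≈1) =
  l₂₂ , l₁₂ , l₂₁ , l₁₁ , ≃F⇒≈F {det (flip A)} {1F}
    (F.trans (F.+-congʳ (F.*-comm (m22 A) (m11 A))) (≈F⇒≃F {det A} {1F} det≈1))

-- Mutation of CGC triples

module CGC (k₁ k₂ k₃ : ℕ) where

  M : Frac
  M = 𝓜 k₁ k₂ k₃

  κ : Fin 3 → Frac
  κ i = natF (kOf k₁ k₂ k₃ i)

  s : Mat → Frac
  s A = M *F m12 A -F tr A

  s-cong : ∀ {A B} → A ≃M B → s A ≃F s B
  s-cong {A} {B} e = -F-cong₂ (F.*-congˡ {M} (≃12 e)) (F.+-cong (≃11 e) (≃22 e))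

  s-flip : ∀ A → s (flip A) ≃F s A
  s-flip A = -F-cong₂ (F.refl {M *F m12 A}) (F.+-comm (m22 A) (m11 A))

  s≃κ : ∀ {A i} → tr A ≃F M *F m12 A -F κ i → s A ≃F κ i
  s≃κ {A} {i} trA = F.trans (-F-cong₂ (F.refl {M *F m12 A}) trA) (x-[x-k]≈k (M *F m12 A) (κ i))

  -M-S-cong : ∀ {A B} C D → A ≃M B → s C ≃F s D → A -M S k₁ k₂ k₃ C ≃M B -M S k₁ k₂ k₃ D
  -M-S-cong C D e sC≃sD = record
    { ≃11 = -F-cong₂ (≃11 e) sC≃sD
    ; ≃12 = -F-cong₂ (≃12 e) (F.refl {0F})
    ; ≃21 = -F-cong₂ (≃21 e) (F.*-congʳ sC≃sD)
    ; ≃22 = -F-cong₂ (≃22 e) sC≃sD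
    }

  ≃M-refl : ∀ {A} → A ≃M A
  ≃M-refl = record { ≃11 = F.refl ; ≃12 = F.refl ; ≃21 = F.refl ; ≃22 = F.refl }

  -- flip is an anti-automorphism that fixes (1,2)-entries, traces, determinants and S.
  flip-*M : ∀ A B → flip (A *M B) ≃M flip B *M flip A
  flip-*M A B = record
    { ≃11 = reverse-dot (m21 A) (m12 B) (m22 A) (m22 B)
    ; ≃12 = reverse-dot (m11 A) (m12 B) (m12 A) (m22 B)
    ; ≃21 = reverse-dot (m21 A) (m11 B) (m22 A) (m21 B)
    ; ≃22 = reverse-dot (m11 A) (m11 B) (m12 A) (m21 B)
    }

  flip-*M-S : ∀ A B C → flip (A *M B -M S k₁ k₂ k₃ C) ≃M flip B *M flip A -M S k₁ k₂ k₃ (flip C)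
  flip-*M-S A B C = -M-S-cong {flip (A *M B)} C (flip C) (flip-*M A B) (F.sym (s-flip C))

  IsCGC-flip : ∀ {A} → IsCGC k₁ k₂ k₃ A → IsCGC k₁ k₂ k₃ (flip A)
  IsCGC-flip {A} (sl , i , cv , trA) =
    InSL2-flip {A} sl , i , cv , ≃F⇒≈F {tr (flip A)} {M *F m12 A -F κ i}
      (F.trans (F.+-comm (m22 A) (m11 A)) (≈F⇒≃F {tr A} trA))

  CGCTriple-flip : ∀ {P Q R} → CGCTriple k₁ k₂ k₃ P Q R → CGCTriple k₁ k₂ k₃ (flip R) (flip Q) (flip P)
  CGCTriple-flip {P} {Q} {R} (cP , cQ , cR , Q≈ , a , b , c , lc , π , a≈ , b≈ , c≈) =
    IsCGC-flip {R} cR , IsCGC-flip {Q} cQ , IsCGC-flip {P} cP ,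
    ≃M⇒≈M (≃M-trans (flip-cong (≈M⇒≃M {Q} {P *M R -M S k₁ k₂ k₃ Q} Q≈)) (flip-*M-S P R Q)) ,
    -- `_∘ₚ_` applies its left factor first: the outer places of the triple are swapped before `π`
    -- sends them to cluster positions.
    a , b , c , lc , transpose 0₃ 2₃ ∘ₚ π , c≈ , b≈ , a≈

  IsCGC-resp : ∀ {A B} → A ≃M B → IsCGC k₁ k₂ k₃ A → IsCGC k₁ k₂ k₃ B
  IsCGC-resp {A} {B} e (sl , i , (a , b , c , lc , y≈) , trA) =
    InSL2-resp e sl , i , (a , b , c , lc , ≃F⇒≈F {sel i a b c} {m12 B} (F.trans (≈F⇒≃F y≈) (≃12 e))) ,
    ≃F⇒≈F {tr B} {M *F m12 B -F κ i} (F.trans (F.sym (F.+-cong (≃11 e) (≃22 e)))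
          (F.trans (≈F⇒≃F {tr A} {M *F m12 A -F κ i} trA) (-F-cong₂ (F.*-congˡ {M} (≃12 e)) (F.refl {κ i}))))

  CGCTriple-resp : ∀ {P Q Q′ R} → Q ≃M Q′ → CGCTriple k₁ k₂ k₃ P Q R → CGCTriple k₁ k₂ k₃ P Q′ R
  CGCTriple-resp {P} {Q} {Q′} {R} e (cP , cQ , cR , Q≈ , a , b , c , lc , π , a≈ , b≈ , c≈) =
    cP , IsCGC-resp e cQ , cR ,
    ≃M⇒≈M (≃M-trans (≃M-sym e) (≃M-trans (≈M⇒≃M {Q} {P *M R -M S k₁ k₂ k₃ Q} Q≈) (-M-S-cong {P *M R} Q Q′ ≃M-refl (s-cong e)))) ,
    a , b , c , lc , π , a≈ , ≃F⇒≈F {sel (π ⟨$⟩ʳ 1₃) a b c} {m12 Q′} (F.trans (≈F⇒≃F b≈) (≃12 e)) , c≈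

  laurent-s : ∀ {A} → InSL2 A → Laurent (s A)
  laurent-s {A} (l₁₁ , l₁₂ , _ , l₂₂ , _) =
    laurent-- {M *F m12 A} {tr A} (laurent-* {M} {m12 A} (laurent-𝓜 k₁ k₂ k₃) l₁₂) (laurent-+ {m11 A} {m22 A} l₁₁ l₂₂)

  laurent-dot : ∀ {f g h e} → Laurent f → Laurent g → Laurent h → Laurent e → Laurent (f *F g +F h *F e)
  laurent-dot {f} {g} {h} {e} lf lg lh le =
    laurent-+ {f *F g} {h *F e} (laurent-* {f} {g} lf lg) (laurent-* {h} {e} lh le)

  InSL2-*M-S : ∀ {P Q R} → InSL2 P → InSL2 Q → InSL2 R →
               det (P *M Q -M S k₁ k₂ k₃ R) ≃F 1F → InSL2 (P *M Q -M S k₁ k₂ k₃ R)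
  InSL2-*M-S {P} {Q} {R} (p₁₁ , p₁₂ , p₂₁ , p₂₂ , _) (q₁₁ , q₁₂ , q₂₁ , q₂₂ , _) slR det≃1 =
      laurent-- {m11 (P *M Q)} {s R} (laurent-dot {m11 P} {m11 Q} {m12 P} {m21 Q} p₁₁ q₁₁ p₁₂ q₂₁)
        (laurent-s {R} slR)
    , laurent-- {m12 (P *M Q)} {0F} (laurent-dot {m11 P} {m12 Q} {m12 P} {m22 Q} p₁₁ q₁₂ p₁₂ q₂₂)
        (laurent-natF 0)
    , laurent-- {m21 (P *M Q)} {s R *F M} (laurent-dot {m21 P} {m11 Q} {m22 P} {m21 Q} p₂₁ q₁₁ p₂₂ q₂₁)
        (laurent-* {s R} {M} (laurent-s {R} slR) (laurent-𝓜 k₁ k₂ k₃))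
    , laurent-- {m22 (P *M Q)} {s R} (laurent-dot {m21 P} {m12 Q} {m22 P} {m22 Q} p₂₁ q₁₂ p₂₂ q₂₂)
        (laurent-s {R} slR)
    , ≃F⇒≈F {det (P *M Q -M S k₁ k₂ k₃ R)} {1F} det≃1

  -- A CGC triple in which the three parities are those of the positions in one labeled cluster.
  record PositionedTriple (P Q R : Mat) : Set where
    field
      {a b c} : Frac
      cluster : LC k₁ k₂ k₃ a b c
      π       : Permutation′ 3

    iP = π ⟨$⟩ʳ 0₃
    iQ = π ⟨$⟩ʳ 1₃
    iR = π ⟨$⟩ʳ 2₃

    field
      a≃   : sel iP a b c ≃F m12 P
      b≃   : sel iQ a b c ≃F m12 Q
      c≃   : sel iR a b c ≃F m12 R
      trP  : tr P ≃F M *F m12 P -F κ iP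
      trQ  : tr Q ≃F M *F m12 Q -F κ iQ
      trR  : tr R ≃F M *F m12 R -F κ iR
      slP  : InSL2 P
      slQ  : InSL2 Q
      slR  : InSL2 R
      detP : det P ≃F 1F
      detQ : det Q ≃F 1F
      Q≃   : Q ≃M P *M R -M S k₁ k₂ k₃ Q

    N : Mat
    N = P *M Q -M S k₁ k₂ k₃ R

    entries : MatrixMutation
    entries = record
      { M = M ; kₐ = κ iP ; k_b = κ iQ ; k_c = κ iR ; s = s Q ; s′ = s R
      ; p₁₁ = m11 P ; a = m12 P ; p₂₁ = m21 P ; p₂₂ = m22 P
      ; q₁₁ = m11 Q ; b = m12 Q ; q₂₁ = m21 Q ; q₂₂ = m22 Q
      ; r₁₁ = m11 R ; c = m12 R ; r₂₁ = m21 R ; r₂₂ = m22 R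
      ; s≈ = s≃κ {Q} {iQ} trQ ; s′≈ = s≃κ {R} {iR} trR
      ; q₁₁≈ = ≃11 Q≃ ; b≈ = ≃12 Q≃ ; q₂₁≈ = ≃21 Q≃ ; q₂₂≈ = ≃22 Q≃
      ; trP = trP ; trQ = trQ ; trR = trR ; detP = detP ; detQ = detQ
      ; markov≈0 = F.trans (F.sym (markov-cong M (κ iP) (κ iQ) (κ iR) a≃ b≃ c≃))
                           (arranged-markov k₁ k₂ k₃ (arrangement π) cluster)
      }

    exchange-relation : m12 N *F m12 R ≃F exchange-poly (κ iR) (m12 P) (m12 Q)
    exchange-relation = MatrixMutation.entry₁₂ entries

    trace-relation : tr N ≃F M *F m12 N -F κ iR
    trace-relation = MatrixMutation.trace entries

    N-inSL2 : InSL2 N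
    N-inSL2 = InSL2-*M-S {P} {Q} {R} slP slQ slR (MatrixMutation.determinant entries)

    -- A CGC triple with middle matrix `N` asks for S_N where `N` was formed with S_R. Both depend
    -- on their matrix only through `s`, and both values of `s` are `κ iR`, since `N` takes over the
    -- position of `R`.
    N≃ : N ≃M P *M Q -M S k₁ k₂ k₃ N
    N≃ = -M-S-cong {P *M Q} R N ≃M-refl
           (F.trans (s≃κ {R} {iR} trR) (F.sym (s≃κ {N} {iR} trace-relation)))

    exchanged-cluster : ExchangedCluster k₁ k₂ k₃ iP iQ iR a b c (m12 N)
    exchanged-cluster = arranged-mutation k₁ k₂ k₃ (m12 N) (arrangement π) cluster
      (F.trans (F.*-congˡ {m12 N} c≃)
        (F.trans exchange-relation (exchange-poly-cong (κ iR) (F.sym a≃) (F.sym b≃))))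

    position-R : ∀ {i} → ClusterVarAt k₁ k₂ k₃ i (m12 R) → iR ≡ i
    position-R {i} cv =
      position-unique iR i (m12 R) (a , b , c , cluster , ≃F⇒≈F {sel iR a b c} {m12 R} c≃) cv

  -- The index in each trace condition is witnessed by a labeled cluster of its own; uniqueness of
  -- positions transports it to the index that `π` assigns in the cluster of the triple.
  positioned : ∀ {P Q R} → CGCTriple k₁ k₂ k₃ P Q R → PositionedTriple P Q R
  positioned {P} {Q} {R} ((slP , iP , cvP , trP) , (slQ , iQ , cvQ , trQ) , (slR , iR , cvR , trR)
                         , Q≈ , a , b , c , lc , π , a≈ , b≈ , c≈) = record
    { cluster = lc
    ; π       = π
    ; a≃      = ≈F⇒≃F a≈
    ; b≃      = ≈F⇒≃F b≈
    ; c≃      = ≈F⇒≃F c≈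
    ; trP     = ≡.subst (λ i → tr P ≃F M *F m12 P -F κ i)
                  (position-unique iP (π ⟨$⟩ʳ 0₃) (m12 P) cvP (a , b , c , lc , a≈)) (≈F⇒≃F trP)
    ; trQ     = ≡.subst (λ i → tr Q ≃F M *F m12 Q -F κ i)
                  (position-unique iQ (π ⟨$⟩ʳ 1₃) (m12 Q) cvQ (a , b , c , lc , b≈)) (≈F⇒≃F trQ)
    ; trR     = ≡.subst (λ i → tr R ≃F M *F m12 R -F κ i)
                  (position-unique iR (π ⟨$⟩ʳ 2₃) (m12 R) cvR (a , b , c , lc , c≈)) (≈F⇒≃F trR)
    ; slP     = slP
    ; slQ     = slQ
    ; slR     = slR
    ; detP    = det≃1 {P} slP
    ; detQ    = det≃1 {Q} slQ
    ; Q≃      = ≈M⇒≃M {Q} {P *M R -M S k₁ k₂ k₃ Q} Q≈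
    }
    where
    det≃1 : ∀ {A} → InSL2 A → det A ≃F 1F
    det≃1 {A} (_ , _ , _ , _ , det≈1) = ≈F⇒≃F {det A} {1F} det≈1

  mutated-triple : ∀ {P Q R} → CGCTriple k₁ k₂ k₃ P Q R → CGCTriple k₁ k₂ k₃ P (P *M Q -M S k₁ k₂ k₃ R) Q
  mutated-triple {P} {Q} {R} PQR@(cP , cQ , _) =
    cP , (N-inSL2 , iR , (a′ , b′ , c′ , cluster , n≈) , ≃F⇒≈F {tr N} {M *F m12 N -F κ iR} trace-relation) , cQ ,
    -- `N` has the cluster position of `R` but stands in the middle of the new triple, and `Q` moves
    -- last; hence the transposition of places 1 and 2.
    ≃M⇒≈M N≃ , a′ , b′ , c′ , cluster , transpose 1₃ 2₃ ∘ₚ π ,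
    ≃F⇒≈F {sel iP a′ b′ c′} {m12 P} (F.trans (F.reflexive kept₁) a≃) ,
    n≈ ,
    ≃F⇒≈F {sel iQ a′ b′ c′} {m12 Q} (F.trans (F.reflexive kept₂) b≃)
    where
    open PositionedTriple (positioned {P} {Q} {R} PQR) hiding (cluster)
    open ExchangedCluster exchanged-cluster
    n≈ : sel iR a′ b′ c′ ≈F m12 N
    n≈ = ≃F⇒≈F {sel iR a′ b′ c′} {m12 N} (F.reflexive exchanged)

  module Mutation (P Q R : Mat) (i : Fin 3)
                  (PQR : CGCTriple k₁ k₂ k₃ P Q R) (cv : ClusterVarAt k₁ k₂ k₃ i (m12 R)) where

    private
      T : PositionedTriple P Q R
      T = positioned {P} {Q} {R} PQR

    N : Mat
    N = P *M Q -M S k₁ k₂ k₃ R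

    exchange-relation : m12 N *F m12 R ≃F exchange-poly (κ i) (m12 P) (m12 Q)
    exchange-relation = ≡.subst (λ i → m12 N *F m12 R ≃F exchange-poly (κ i) (m12 P) (m12 Q))
      (PositionedTriple.position-R T {i} cv) (PositionedTriple.exchange-relation T)

    trace-relation : tr N ≃F M *F m12 N -F κ i
    trace-relation = ≡.subst (λ i → tr N ≃F M *F m12 N -F κ i)
      (PositionedTriple.position-R T {i} cv) (PositionedTriple.trace-relation T)

    inSL2 : InSL2 N
    inSL2 = PositionedTriple.N-inSL2 T

  module FlippedMutation (P Q R : Mat) (i : Fin 3)
                         (PQR : CGCTriple k₁ k₂ k₃ P Q R) (cv : ClusterVarAt k₁ k₂ k₃ i (m12 P)) where

    private
      RQP : CGCTriple k₁ k₂ k₃ (flip R) (flip Q) (flip P)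
      RQP = CGCTriple-flip {P} {Q} {R} PQR

    N N′ : Mat
    N  = flip R *M flip Q -M S k₁ k₂ k₃ (flip P)
    N′ = Q *M R -M S k₁ k₂ k₃ P

    N′≃flipN : N′ ≃M flip N
    -- On the left `flip (flip N′)` computes to `N′`.
    N′≃flipN = flip-cong (flip-*M-S Q R P)

    exchange-relation : m12 N′ *F m12 P ≃F exchange-poly (κ i) (m12 Q) (m12 R)
    exchange-relation = F.trans (F.*-congʳ (≃12 N′≃flipN))
      (F.trans (Mutation.exchange-relation (flip R) (flip Q) (flip P) i RQP cv)
               (exchange-poly-comm (κ i) (m12 R) (m12 Q)))

    trace-relation : tr N′ ≃F M *F m12 N′ -F κ i
    trace-relation = F.trans (F.+-cong (≃11 N′≃flipN) (≃22 N′≃flipN)) (F.trans (F.+-comm (m22 N) (m11 N))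
      (F.trans (Mutation.trace-relation (flip R) (flip Q) (flip P) i RQP cv)
               (-F-cong₂ (F.*-congˡ {M} (F.sym (≃12 N′≃flipN))) (F.refl {κ i}))))

    inSL2 : InSL2 N′
    inSL2 = InSL2-resp {flip N} {N′} (≃M-sym N′≃flipN) (InSL2-flip {N} (Mutation.inSL2 (flip R) (flip Q) (flip P) i RQP cv))

    triple : CGCTriple k₁ k₂ k₃ Q N′ R
    triple = CGCTriple-resp {Q} {flip N} {N′} {R} (≃M-sym N′≃flipN)
      (CGCTriple-flip {flip R} {N} {flip Q} (mutated-triple {flip R} {flip Q} {flip P} RQP))

theorem4p6 : (k₁ k₂ k₃ : ℕ) (P Q R : Mat) →
    CGCTriple k₁ k₂ k₃ P Q R →
    (ia ic : Fin 3) →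
    ClusterVarAt k₁ k₂ k₃ ia (m12 P) → ClusterVarAt k₁ k₂ k₃ ic (m12 R) →
    -- (1)
    (m12 (P *M Q -M S k₁ k₂ k₃ R) *F m12 R
       ≈F m12 P *F m12 P +F natF (kOf k₁ k₂ k₃ ic) *F m12 P *F m12 Q +F m12 Q *F m12 Q)
    × (m12 (Q *M R -M S k₁ k₂ k₃ P) *F m12 P
       ≈F m12 Q *F m12 Q +F natF (kOf k₁ k₂ k₃ ia) *F m12 Q *F m12 R +F m12 R *F m12 R)
    -- (2)
    × (tr (P *M Q -M S k₁ k₂ k₃ R)
       ≈F 𝓜 k₁ k₂ k₃ *F m12 (P *M Q -M S k₁ k₂ k₃ R) -F natF (kOf k₁ k₂ k₃ ic))
    × (tr (Q *M R -M S k₁ k₂ k₃ P)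
       ≈F 𝓜 k₁ k₂ k₃ *F m12 (Q *M R -M S k₁ k₂ k₃ P) -F natF (kOf k₁ k₂ k₃ ia))
    -- (3)
    × InSL2 (P *M Q -M S k₁ k₂ k₃ R)
    × InSL2 (Q *M R -M S k₁ k₂ k₃ P)
    -- in particular
    × CGCTriple k₁ k₂ k₃ P (P *M Q -M S k₁ k₂ k₃ R) Q
    × CGCTriple k₁ k₂ k₃ Q (Q *M R -M S k₁ k₂ k₃ P) R
theorem4p6 k₁ k₂ k₃ P Q R PQR ia ic cvP cvR =
    ≃F⇒≈F {m12 (P *M Q -M S k₁ k₂ k₃ R) *F m12 R} {exchange-poly (κ ic) (m12 P) (m12 Q)}
      (Mutation.exchange-relation P Q R ic PQR cvR)
  , ≃F⇒≈F {m12 (Q *M R -M S k₁ k₂ k₃ P) *F m12 P} {exchange-poly (κ ia) (m12 Q) (m12 R)}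
      (FlippedMutation.exchange-relation P Q R ia PQR cvP)
  , ≃F⇒≈F {tr (P *M Q -M S k₁ k₂ k₃ R)} {M *F m12 (P *M Q -M S k₁ k₂ k₃ R) -F κ ic}
      (Mutation.trace-relation P Q R ic PQR cvR)
  , ≃F⇒≈F {tr (Q *M R -M S k₁ k₂ k₃ P)} {M *F m12 (Q *M R -M S k₁ k₂ k₃ P) -F κ ia}
      (FlippedMutation.trace-relation P Q R ia PQR cvP)
  , Mutation.inSL2 P Q R ic PQR cvR
  , FlippedMutation.inSL2 P Q R ia PQR cvP
  , mutated-triple {P} {Q} {R} PQR
  , FlippedMutation.triple P Q R ia PQR cvP
  where open CGC k₁ k₂ k₃
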